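{- Let $A=(a_{i,j})$ be an $n\times n$ matrix over a field $\mathbb{F}$ of characteristic $p>0$. Then \[ \det(A)=\sum_{\substack{P\in\operatorname{PP}(n)\\ |P|\le p-1}}\operatorname{sgn}(P)\,|P|!\,\prod_{i=1}^n \begin{cases} \sum_{j\sim_P i,\ j\neq i} a_{i,j} & \text{if } i\sim_P i,\\ a_{i,i}+\sum_{j:\ j\sim_P j} a_{i,j} & \text{if } i\not\sim_P i,\end{cases} \] where $\operatorname{sgn}(P)=\prod_{S\in P}(-1)^{|S|+1}$.
   Context: A partial partition of $[n]=\{1,\dots,n\}$ is a set $P$ of pairwise disjoint nonempty subsets of $[n]$ (not necessarily covering $[n]$); $\operatorname{PP}(n)$ is the set of these; $|P|$ is the number of parts; $i\sim_P j$ means some part of $P$ contains both $i$ and $j$. Empty sums are $0$. -}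

module Defs where

open import Level using (Level)
open import Data.Nat using (ℕ; zero; suc; _<_)
open import Data.Nat.Base using (_!; _≤ᵇ_)
open import Data.Bool using (Bool; true; false; _∧_; _∨_; not; if_then_else_)
open import Data.Fin using (Fin; zero; suc; punchIn; toℕ)
open import Data.Fin.Properties using (_≟_)
open import Data.Vec using (Vec; []; _∷_; lookup)
open import Data.Fin.Subset using (Subset; inside; outside)
open import Data.List using (List; []; _∷_; _++_; map; filter; length; foldr)
open import Data.Product using (Σ; _×_; _,_)
open import Relation.Nullary using (¬_; does)
open import Relation.Unary using (Decidable)
open import Algebra.Bundles using (CommutativeRing)

IsField : ∀ {c ℓ} → CommutativeRing c ℓ → Set _
IsField R = (¬ (1# ≈ 0#)) × (∀ x → ¬ (x ≈ 0#) → Σ Carrier λ y → x * y ≈ 1#)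
  where open CommutativeRing R

module _ {c ℓ} (R : CommutativeRing c ℓ) where
  open CommutativeRing R using (Carrier; _≈_; _+_; _*_; -_; 0#; 1#)

  natCast : ℕ → Carrier
  natCast zero    = 0#
  natCast (suc k) = 1# + natCast k

  neg1^ : ℕ → Carrier
  neg1^ zero    = 1#
  neg1^ (suc k) = - neg1^ k

  HasCharacteristic : ℕ → Set ℓ
  HasCharacteristic p = (0 < p) × (natCast p ≈ 0#) × (∀ m → 0 < m → m < p → ¬ (natCast m ≈ 0#))

  ΣFin : ∀ n → (Fin n → Carrier) → Carrier
  ΣFin zero    f = 0#
  ΣFin (suc n) f = f zero + ΣFin n (λ i → f (suc i))

  ΠFin : ∀ n → (Fin n → Carrier) → Carrier
  ΠFin zero    f = 1#
  ΠFin (suc n) f = f zero * ΠFin n (λ i → f (suc i))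

  ΣList : ∀ {a} {A : Set a} → List A → (A → Carrier) → Carrier
  ΣList []       f = 0#
  ΣList (x ∷ xs) f = f x + ΣList xs f

  det : ∀ n → (Fin n → Fin n → Carrier) → Carrier
  det zero    A = 1#
  det (suc n) A = ΣFin (suc n) λ j →
    neg1^ (toℕ j) * (A zero j * det n (λ i k → A (suc i) (punchIn j k)))

allSubsets : ∀ n → List (Subset n)
allSubsets zero    = [] ∷ []
allSubsets (suc n) = map (inside ∷_) (allSubsets n) ++ map (outside ∷_) (allSubsets n)

-- all sublists of a list; for a duplicate-free list these correspond
-- exactly (once each) to the subsets of its underlying set
sublists : ∀ {a} {A : Set a} → List A → List (List A)
sublists []       = [] ∷ []
sublists (x ∷ xs) = map (x ∷_) (sublists xs) ++ sublists xs

_∈ᵇ_ : ∀ {n} → Fin n → Subset n → Bool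
i ∈ᵇ S = lookup S i

anyFin : ∀ n → (Fin n → Bool) → Bool
anyFin zero    f = false
anyFin (suc n) f = f zero ∨ anyFin n (λ i → f (suc i))

nonemptyᵇ : ∀ {n} → Subset n → Bool
nonemptyᵇ {n} S = anyFin n (λ i → i ∈ᵇ S)

disjointᵇ : ∀ {n} → Subset n → Subset n → Bool
disjointᵇ {n} S T = not (anyFin n (λ i → i ∈ᵇ S ∧ i ∈ᵇ T))

allL : ∀ {a} {A : Set a} → (A → Bool) → List A → Bool
allL p []       = true
allL p (x ∷ xs) = p x ∧ allL p xs

anyL : ∀ {a} {A : Set a} → (A → Bool) → List A → Bool
anyL p []       = false
anyL p (x ∷ xs) = p x ∨ anyL p xs

-- pairwise disjoint (list elements here are distinct subsets)
pairwiseDisjointᵇ : ∀ {n} → List (Subset n) → Bool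
pairwiseDisjointᵇ []       = true
pairwiseDisjointᵇ (S ∷ Ss) = allL (disjointᵇ S) Ss ∧ pairwiseDisjointᵇ Ss

isPartialPartitionᵇ : ∀ {n} → List (Subset n) → Bool
isPartialPartitionᵇ P = allL nonemptyᵇ P ∧ pairwiseDisjointᵇ P


filterᵇ : ∀ {a} {A : Set a} → (A → Bool) → List A → List A
filterᵇ p []       = []
filterᵇ p (x ∷ xs) = if p x then x ∷ filterᵇ p xs else filterᵇ p xs

-- PP(n): every set of pairwise disjoint nonempty subsets of [n], each
-- listed exactly once (as a list of distinct subsets)
PP : ∀ n → List (List (Subset n))
PP n = filterᵇ isPartialPartitionᵇ (sublists (allSubsets n))

numParts : ∀ {n} → List (Subset n) → ℕ
numParts = length

card : ∀ {n} → Subset n → ℕ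
card []            = 0
card (true  ∷ S)   = suc (card S)
card (false ∷ S)   = card S

_∼[_]_ : ∀ {n} → Fin n → List (Subset n) → Fin n → Bool
i ∼[ P ] j = anyL (λ S → i ∈ᵇ S ∧ j ∈ᵇ S) P

module _ {c ℓ} (R : CommutativeRing c ℓ) where
  open CommutativeRing R using (Carrier; _≈_; _+_; _*_; -_; 0#; 1#)

  sgn : ∀ {n} → List (Subset n) → Carrier
  sgn P = foldr (λ S acc → neg1^ R (suc (card S)) * acc) 1# P

  factor : ∀ n → (Fin n → Fin n → Carrier) → List (Subset n) → Fin n → Carrier
  factor n A P i =
    if i ∼[ P ] i
    then ΣFin R n (λ j → if (i ∼[ P ] j) ∧ not (does (i ≟ j)) then A i j else 0#)
    else A i i + ΣFin R n (λ j → if j ∼[ P ] j then A i j else 0#)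

  rhs : ∀ (p n : ℕ) → (Fin n → Fin n → Carrier) → Carrier
  rhs p n A = ΣList R (filterᵇ (λ P → suc (numParts P) ≤ᵇ p) (PP n)) λ P →
    sgn P * (natCast R (numParts P !) * ΠFin R n (factor n A P))

{-# OPTIONS --safe #-}

-- Over any commutative ring the sum over all partial partitions, without the bound on |P|,
-- equals det A; in characteristic p the terms with |P| ≥ p vanish because p divides |P|!.
--
-- Number the parts and let r of them exist beforehand, part s contributing a given column
-- c s to the factors of its elements and every c s contributing to the factors of the
-- uncovered elements.  Then the sum is κ r · det, with κ k = (−1)ᵏ k!, whatever the columns
-- are.  This goes by induction on n.  The first factor is linear in the first row; say the
-- first element x lies in no part, joins part s, or opens a new part.
--  * The coefficient of the diagonal entry is right because − r κ r − κ (r + 1) = κ r,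
--    and the entries of the columns c s cancel.
--  * For the entry (x, j), sort by the part of j: merging x into j adds column x to column j,
--    and the coefficient is κ r (det M − det (M with column x added to column j)), M being the
--    minor.  This is the cofactor.
module Submission where

open import Defs
open import Algebra.Bundles using (CommutativeRing)
open import Data.Bool using (Bool; true; false; if_then_else_; T; _∧_; _∨_; not)
open import Data.Bool.Properties using (∧-zeroʳ; ∨-identityʳ)
open import Data.Fin using (Fin; zero; suc; punchIn; toℕ)
open import Data.Fin.Properties using (_≟_)
open import Data.Fin.Subset using (Subset; inside; outside)
open import Data.List as List using (List; []; _∷_; _++_; length)
open import Data.Maybe as Maybe using (Maybe; nothing; just)
open import Data.Nat as ℕ using (ℕ; zero; suc; _≤_; _<_; z≤n; s≤s; _≡ᵇ_; _≤ᵇ_; _!)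
import Data.Nat.Properties as ℕ
open import Data.Nat.Divisibility using (divides; m≤n⇒m!∣n!; m∣m*n; ∣-trans)
open import Data.Product using (_,_)
open import Data.Unit using (tt)
open import Data.Vec using (Vec; []; _∷_; lookup; map)
open import Data.Vec.Properties using (lookup-map)
open import Relation.Binary.PropositionalEquality as ≡ using (_≡_)
open import Relation.Nullary using (does; yes; no)

-- Finite sums and products over a commutative ring.

module Summation {c ℓ} (R : CommutativeRing c ℓ) where
  open CommutativeRing R public hiding (zero)
  open import Algebra.Properties.Ring ring public using (-‿distribˡ-*; -‿distribʳ-*; -1*x≈-x; -‿involutive; -‿+-comm)
  open import Algebra.Properties.CommutativeSemigroup +-commutativeSemigroup public using () renaming (interchange to +-interchange; x∙yz≈y∙xz to +-leftComm)
  open import Algebra.Properties.CommutativeSemigroup *-commutativeSemigroup public using () renaming (interchange to *-interchange; x∙yz≈y∙xz to *-leftComm)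
  open import Algebra.Solver.Ring.NaturalCoefficients.Default commutativeSemiring public
    using (solve; _:=_; _:+_; _:*_)
  open import Relation.Binary.Reasoning.Setoid setoid public

  [_] : Bool → Carrier
  [ b ] = if b then 1# else 0#

  x-x+y≈y : ∀ x y → - x + (x + y) ≈ y
  x-x+y≈y x y = begin
    - x + (x + y)  ≈⟨ +-assoc (- x) x y ⟨
    (- x + x) + y  ≈⟨ +-congʳ (-‿inverseˡ x) ⟩
    0# + y         ≈⟨ +-identityˡ y ⟩
    y              ∎

  opaque
    -- Opaque, so that a sum over `Fin (suc n)` stays folded and its summand can be inferred by
    -- unification.
    ∑ : ∀ {n} → (Fin n → Carrier) → Carrier
    ∑ {n} = ΣFin R n

    ∑-def : ∀ {n} (f : Fin n → Carrier) → ∑ f ≡ ΣFin R n f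
    ∑-def f = ≡.refl

    ∑-suc : ∀ {n} (f : Fin (suc n) → Carrier) → ∑ f ≡ f zero + ∑ (λ i → f (suc i))
    ∑-suc f = ≡.refl

    ∑-cong : ∀ {n} {f g : Fin n → Carrier} → (∀ i → f i ≈ g i) → ∑ f ≈ ∑ g
    ∑-cong {zero}  h = refl
    ∑-cong {suc n} h = +-cong (h zero) (∑-cong (λ i → h (suc i)))

    ∑-0 : ∀ {n} → ∑ {n} (λ _ → 0#) ≈ 0#
    ∑-0 {zero}  = refl
    ∑-0 {suc n} = trans (+-identityˡ _) (∑-0 {n})

    ∑-+ : ∀ {n} (f g : Fin n → Carrier) → ∑ (λ i → f i + g i) ≈ ∑ f + ∑ g
    ∑-+ {zero}  f g = sym (+-identityˡ 0#)
    ∑-+ {suc n} f g = trans (+-congˡ (∑-+ (λ i → f (suc i)) (λ i → g (suc i)))) (+-interchange _ _ _ _)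

    ∑-*ˡ : ∀ {n} a (f : Fin n → Carrier) → ∑ (λ i → a * f i) ≈ a * ∑ f
    ∑-*ˡ {zero}  a f = sym (zeroʳ a)
    ∑-*ˡ {suc n} a f = trans (+-congˡ (∑-*ˡ a (λ i → f (suc i)))) (sym (distribˡ a _ _))

  ∑-*ʳ : ∀ {n} (f : Fin n → Carrier) a → ∑ (λ i → f i * a) ≈ ∑ f * a
  ∑-*ʳ f a = trans (∑-cong (λ i → *-comm (f i) a)) (trans (∑-*ˡ a f) (*-comm a _))

  opaque
    unfolding ∑

    ∑-swap : ∀ {m n} (f : Fin m → Fin n → Carrier) →
             ∑ (λ i → ∑ (λ j → f i j)) ≈ ∑ (λ j → ∑ (λ i → f i j))
    ∑-swap {zero}  {n} f = sym (∑-0 {n})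
    ∑-swap {suc m} {n} f = trans (+-congˡ (∑-swap (λ i → f (suc i)))) (sym (∑-+ (f zero) _))

    ∑-punchIn : ∀ {n} (j : Fin (suc n)) (f : Fin (suc n) → Carrier) →
                ∑ f ≈ f j + ∑ (λ k → f (punchIn j k))
    ∑-punchIn         zero    f = refl
    ∑-punchIn {suc n} (suc j) f = trans (+-congˡ (∑-punchIn j (λ k → f (suc k)))) (+-leftComm _ _ _)

  ∏ : ∀ {n} → (Fin n → Carrier) → Carrier
  ∏ {n} = ΠFin R n

  ∏-cong : ∀ {n} {f g : Fin n → Carrier} → (∀ i → f i ≈ g i) → ∏ f ≈ ∏ g
  ∏-cong {zero}  h = refl
  ∏-cong {suc n} h = *-cong (h zero) (∏-cong (λ i → h (suc i)))

  ∏-* : ∀ {n} (f g : Fin n → Carrier) → ∏ (λ i → f i * g i) ≈ ∏ f * ∏ g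
  ∏-* {zero}  f g = sym (*-identityˡ 1#)
  ∏-* {suc n} f g = trans (*-congˡ (∏-* (λ i → f (suc i)) (λ i → g (suc i)))) (*-interchange _ _ _ _)

-- Determinants: expansion along a column, and adding a column to another.

-- For k = punchIn j k′ ≢ j, the position of j among the indices other than k.
punchOther : ∀ {m} → Fin (suc (suc m)) → Fin (suc m) → Fin (suc m)
punchOther         zero    k        = zero
punchOther         (suc j) zero     = j
punchOther {suc m} (suc j) (suc k)  = suc (punchOther j k)

punchIn-punchOther : ∀ {m} (j : Fin (suc (suc m))) k → punchIn (punchIn j k) (punchOther j k) ≡ j
punchIn-punchOther         zero    k       = ≡.refl
punchIn-punchOther         (suc j) zero    = ≡.refl
punchIn-punchOther {suc m} (suc j) (suc k) = ≡.cong suc (punchIn-punchOther j k)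

-- Both sides list in increasing order the indices other than `j` and `punchIn j k`, so deleting
-- these two columns in either order leaves the same minor.
punchIn-comm : ∀ {m} (j : Fin (suc (suc m))) k t →
  punchIn (punchIn j k) (punchIn (punchOther j k) t) ≡ punchIn j (punchIn k t)
punchIn-comm         zero    k       t       = ≡.refl
punchIn-comm         (suc j) zero    t       = ≡.refl
punchIn-comm {suc m} (suc j) (suc k) zero    = ≡.refl
punchIn-comm {suc m} (suc j) (suc k) (suc t) = ≡.cong suc (punchIn-comm j k t)

≟-punchIn : ∀ {m} (j : Fin (suc m)) k → does (j ≟ punchIn j k) ≡ false
≟-punchIn zero    k       = ≡.refl
≟-punchIn (suc j) zero    = ≡.refl
≟-punchIn (suc j) (suc k) = ≟-punchIn j k

≟-refl : ∀ {m} (j : Fin m) → does (j ≟ j) ≡ true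
≟-refl zero    = ≡.refl
≟-refl (suc j) = ≟-refl j

module Determinant {c ℓ} (R : CommutativeRing c ℓ) where
  open Summation R

  Matrix : ℕ → Set c
  Matrix n = Fin n → Fin n → Carrier

  minor : ∀ {n} → Fin (suc n) → Fin (suc n) → Matrix (suc n) → Matrix n
  minor i j M k l = M (punchIn i k) (punchIn j l)

  sign : ∀ {n} → Fin n → Carrier
  sign i = neg1^ R (toℕ i)

  opaque
    unfolding ∑

    Det : ∀ {n} → Matrix n → Carrier
    Det {n} = det R n

    Det-def : ∀ {n} (M : Matrix n) → Det M ≡ det R n M
    Det-def M = ≡.refl

    Det-zero : ∀ (M : Matrix 0) → Det M ≡ 1#
    Det-zero M = ≡.refl

    Det-row : ∀ {n} (M : Matrix (suc n)) →
      Det M ≡ ∑ (λ j → sign j * (M zero j * Det (minor zero j M)))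
    Det-row M = ≡.refl

  Det-cong : ∀ {n} {M N : Matrix n} → (∀ i j → M i j ≈ N i j) → Det M ≈ Det N
  Det-cong {zero}  {M} {N} h = reflexive (≡.trans (Det-zero M) (≡.sym (Det-zero N)))
  Det-cong {suc n} {M} {N} h = begin
    Det M                                                    ≡⟨ Det-row M ⟩
    ∑ (λ j → sign j * (M zero j * Det (minor zero j M)))
      ≈⟨ ∑-cong (λ j → *-congˡ (*-cong (h zero j) (Det-cong (λ i k → h (suc i) (punchIn j k))))) ⟩
    ∑ (λ j → sign j * (N zero j * Det (minor zero j N)))    ≡⟨ Det-row N ⟨
    Det N                                                    ∎

  -- Deleting the smaller of the two indices first lowers the position of the larger one by one, so
  -- the two orders of deletion have opposite signs.
  sign-punchOther : ∀ {m} (j : Fin (suc (suc m))) k →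
    sign (punchIn j k) * sign (punchOther j k) ≈ - (sign j * sign k)
  sign-punchOther         zero    k       = trans (*-identityʳ _) (-‿cong (sym (*-identityˡ _)))
  sign-punchOther         (suc j) zero    = begin
    1# * sign j          ≈⟨ *-comm _ _ ⟩
    sign j * 1#          ≈⟨ -‿involutive _ ⟨
    - - (sign j * 1#)    ≈⟨ -‿cong (-‿distribˡ-* _ _) ⟩
    - (- sign j * 1#)    ∎
  sign-punchOther {suc m} (suc j) (suc k) = begin
    - sign (punchIn j k) * - sign (punchOther j k)  ≈⟨ -x*-y _ _ ⟩
    sign (punchIn j k) * sign (punchOther j k)      ≈⟨ sign-punchOther j k ⟩
    - (sign j * sign k)                             ≈⟨ -‿cong (-x*-y _ _) ⟨
    - (- sign j * - sign k)                         ∎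
    where
    -x*-y : ∀ x y → - x * - y ≈ x * y
    -x*-y x y = trans (sym (-‿distribˡ-* _ _)) (trans (-‿cong (sym (-‿distribʳ-* _ _))) (-‿involutive _))

  -- Induction on the size, since `det` is an expansion along row 0. There the term of `j` is kept,
  -- and every other minor is expanded along what was column `j`. After exchanging the sums, the
  -- inner one is the row expansion of `minor (suc i) j M`.
  Det-column : ∀ {n} (j : Fin (suc n)) (M : Matrix (suc n)) →
    Det M ≈ ∑ (λ i → (sign i * sign j) * (M i j * Det (minor i j M)))
  Det-column {zero} zero M = begin
    Det M                                                          ≡⟨ Det-row M ⟩
    ∑ (λ i → sign i * (M zero i * Det (minor zero i M)))
      ≈⟨ ∑-cong (λ { zero → *-congʳ (sym (*-identityˡ 1#)) }) ⟩
    ∑ (λ i → (sign i * 1#) * (M i zero * Det (minor i zero M))) ∎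
  Det-column {suc n} j M = begin
    Det M
      ≡⟨ Det-row M ⟩
    ∑ (λ k → term k)
      ≈⟨ ∑-punchIn j term ⟩
    term j + ∑ (λ k → term (punchIn j k))
      ≈⟨ +-cong (*-congʳ (sym (*-identityˡ _))) (∑-cong step) ⟩
    (1# * sign j) * (M zero j * Det (minor zero j M)) + ∑ (λ k → ∑ (λ i → g i k))
      ≈⟨ +-congˡ (∑-swap (λ k i → g i k)) ⟩
    (1# * sign j) * (M zero j * Det (minor zero j M)) + ∑ (λ i → ∑ (λ k → g i k))
      ≈⟨ +-congˡ (∑-cong λ i → ∑-*ˡ _ _) ⟩
    (1# * sign j) * (M zero j * Det (minor zero j M))
      + ∑ (λ i → (- sign i * sign j) * ∑ (λ k → M (suc i) j * h i k))
      ≈⟨ +-congˡ (∑-cong λ i → *-congˡ (trans (∑-*ˡ _ _) (*-congˡ (reflexive (≡.sym (Det-row (minor (suc i) j M))))))) ⟩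
    (1# * sign j) * (M zero j * Det (minor zero j M))
      + ∑ (λ i → (- sign i * sign j) * (M (suc i) j * Det (minor (suc i) j M)))
      ≡⟨ ∑-suc _ ⟨
    ∑ (λ i → (sign i * sign j) * (M i j * Det (minor i j M))) ∎
    where
    term : Fin (suc (suc n)) → Carrier
    term k = sign k * (M zero k * Det (minor zero k M))

    h : Fin (suc n) → Fin (suc n) → Carrier
    h i k = sign k * (M zero (punchIn j k) * Det (minor zero k (minor (suc i) j M)))

    g : Fin (suc n) → Fin (suc n) → Carrier
    g i k = (- sign i * sign j) * (M (suc i) j * h i k)

    step : ∀ k → term (punchIn j k) ≈ ∑ (λ i → g i k)
    step k = begin
      s * (m * Det (minor zero (punchIn j k) M))
        ≈⟨ *-congˡ (*-congˡ (Det-column j′ (minor zero (punchIn j k) M))) ⟩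
      s * (m * ∑ (λ i → (sign i * sign j′) * (M (suc i) (punchIn (punchIn j k) j′) * d i)))
        ≈⟨ *-assoc s m _ ⟨
      (s * m) * ∑ (λ i → (sign i * sign j′) * (M (suc i) (punchIn (punchIn j k) j′) * d i))
        ≈⟨ ∑-*ˡ (s * m) _ ⟨
      ∑ (λ i → (s * m) * ((sign i * sign j′) * (M (suc i) (punchIn (punchIn j k) j′) * d i)))
        ≈⟨ ∑-cong rearrange ⟩
      ∑ (λ i → g i k) ∎
      where
      j′ = punchOther j k
      s  = sign (punchIn j k)
      m  = M zero (punchIn j k)

      d : Fin (suc n) → Carrier
      d i = Det (minor i j′ (minor zero (punchIn j k) M))

      rearrange : ∀ i → (s * m) * ((sign i * sign j′) * (M (suc i) (punchIn (punchIn j k) j′) * d i)) ≈ g i k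
      rearrange i = begin
        (s * m) * ((sign i * sign j′) * (M (suc i) (punchIn (punchIn j k) j′) * d i))
          ≈⟨ *-congˡ (*-congˡ (*-cong
               (reflexive (≡.cong (M (suc i)) (punchIn-punchOther j k)))
               (Det-cong λ a b → reflexive (≡.cong (M (suc (punchIn i a))) (punchIn-comm j k b))))) ⟩
        (s * m) * ((sign i * sign j′) * (M (suc i) j * e))
          ≈⟨ solve 6 (λ s m si sj x e → (s :* m) :* ((si :* sj) :* (x :* e)) := (s :* sj) :* ((si :* x) :* (m :* e)))
               refl s m (sign i) (sign j′) (M (suc i) j) e ⟩
        (s * sign j′) * ((sign i * M (suc i) j) * (m * e))
          -- The minus sign turns `sign i` into the sign of row `suc i`.
          ≈⟨ *-congʳ (sign-punchOther j k) ⟩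
        - (sign j * sign k) * ((sign i * M (suc i) j) * (m * e))
          ≈⟨ -‿distribˡ-* _ _ ⟨
        - ((sign j * sign k) * ((sign i * M (suc i) j) * (m * e)))
          ≈⟨ -‿cong (solve 6 (λ sj sk si x m e → (sj :* sk) :* ((si :* x) :* (m :* e)) := (si :* sj) :* (x :* (sk :* (m :* e))))
               refl (sign j) (sign k) (sign i) (M (suc i) j) m e) ⟩
        - ((sign i * sign j) * (M (suc i) j * h i k))
          ≈⟨ -‿distribˡ-* _ _ ⟩
        - (sign i * sign j) * (M (suc i) j * h i k)
          ≈⟨ *-congʳ (-‿distribˡ-* _ _) ⟩
        g i k ∎
        where e = Det (minor zero k (minor (suc i) j M))

  addColumn : ∀ {n} → Fin n → (Fin n → Carrier) → Matrix n → Matrix n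
  addColumn j b M i k = M i k + [ does (j ≟ k) ] * b i

  -- Expansion along column `j`: the minors that omit this column are unaffected by the addition.
  Det-addColumn : ∀ {n} (j : Fin (suc n)) b (M : Matrix (suc n)) →
    Det (addColumn j b M) ≈ Det M + ∑ (λ i → (sign i * sign j) * (b i * Det (minor i j M)))
  Det-addColumn j b M = begin
    Det (addColumn j b M)
      ≈⟨ Det-column j _ ⟩
    ∑ (λ i → (sign i * sign j) * (addColumn j b M i j * Det (minor i j (addColumn j b M))))
      ≈⟨ ∑-cong (λ i → *-congˡ (*-cong (entry i) (Det-cong {N = minor i j M} (λ k l → other (punchIn i k) l)))) ⟩
    ∑ (λ i → (sign i * sign j) * ((M i j + b i) * Det (minor i j M)))
      ≈⟨ ∑-cong (λ i → trans (*-congˡ (distribʳ _ _ _)) (distribˡ _ _ _)) ⟩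
    ∑ (λ i → (sign i * sign j) * (M i j * Det (minor i j M)) + (sign i * sign j) * (b i * Det (minor i j M)))
      ≈⟨ ∑-+ _ _ ⟩
    ∑ (λ i → (sign i * sign j) * (M i j * Det (minor i j M))) + ∑ (λ i → (sign i * sign j) * (b i * Det (minor i j M)))
      ≈⟨ +-congʳ (Det-column j M) ⟨
    Det M + ∑ (λ i → (sign i * sign j) * (b i * Det (minor i j M))) ∎
    where
    entry : ∀ i → addColumn j b M i j ≈ M i j + b i
    entry i rewrite ≟-refl j = +-congˡ (*-identityˡ (b i))

    other : ∀ i k → addColumn j b M i (punchIn j k) ≈ M i (punchIn j k)
    other i k rewrite ≟-punchIn j k = trans (+-congˡ (zeroˡ (b i))) (+-identityʳ _)

  -- Expanding row 0 and then column 0, the coefficient of the entry (0, j) is minus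
  -- the determinant of the minor with column j replaced by column 0.
  Det-contract : ∀ {n} (M : Matrix (suc n)) →
    let M′ = minor zero zero M in
    Det M ≈ M zero zero * Det M′
      + ∑ (λ j → M zero (suc j) * (Det M′ + - Det (addColumn j (λ i → M (suc i) zero) M′)))
  Det-contract {n} M = begin
    Det M
      ≡⟨ Det-row M ⟩
    ∑ (λ j → sign j * (M zero j * Det (minor zero j M)))
      ≡⟨ ∑-suc _ ⟩
    1# * (M zero zero * Det (minor zero zero M)) + ∑ (λ j → - sign j * (M zero (suc j) * Det (minor zero (suc j) M)))
      ≈⟨ +-cong (*-identityˡ _) (∑-cong (cofactor M)) ⟩
    _ ∎
    where
    -- Stated for every size, so that the index `j` can force the minor to have a column to expand
    -- along.
    cofactor : ∀ {n} (M : Matrix (suc n)) j → let M′ = minor zero zero M in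
      - sign j * (M zero (suc j) * Det (minor zero (suc j) M))
        ≈ M zero (suc j) * (Det M′ + - Det (addColumn j (λ i → M (suc i) zero) M′))
    cofactor {suc n} M j = begin
      - sign j * (M zero (suc j) * Det (minor zero (suc j) M))
        ≈⟨ *-congˡ (*-congˡ (Det-column zero (minor zero (suc j) M))) ⟩
      - sign j * (M zero (suc j) * ∑ (λ i → (sign i * 1#) * (b i * m i j)))
        ≈⟨ *-leftComm _ _ _ ⟩
      M zero (suc j) * (- sign j * ∑ (λ i → (sign i * 1#) * (b i * m i j)))
        ≈⟨ *-congˡ (trans (sym (-‿distribˡ-* _ _)) (-‿cong (sym (∑-*ˡ _ _)))) ⟩
      M zero (suc j) * - ∑ (λ i → sign j * ((sign i * 1#) * (b i * m i j)))
        ≈⟨ *-congˡ (-‿cong (∑-cong λ i → trans (sym (*-assoc _ _ _)) (*-congʳ (trans (*-comm _ _) (*-congʳ (*-identityʳ _)))))) ⟩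
      M zero (suc j) * - C j
        ≈⟨ *-congˡ (diff j) ⟩
      M zero (suc j) * (Det M′ + - Det (addColumn j b M′)) ∎
      where
      M′ = minor zero zero M

      b : Fin (suc n) → Carrier
      b i = M (suc i) zero

      m : Fin (suc n) → Fin (suc n) → Carrier
      m i j = Det (minor i j M′)

      C : Fin (suc n) → Carrier
      C j = ∑ (λ i → (sign i * sign j) * (b i * m i j))

      diff : ∀ j → - C j ≈ Det M′ + - Det (addColumn j b M′)
      diff j = begin
        - C j                             ≈⟨ x-x+y≈y (Det M′) (- C j) ⟨
        - Det M′ + (Det M′ + - C j)       ≈⟨ +-leftComm _ _ _ ⟩
        Det M′ + (- Det M′ + - C j)       ≈⟨ +-congˡ (-‿+-comm _ _) ⟩
        Det M′ + - (Det M′ + C j)         ≈⟨ +-congˡ (-‿cong (Det-addColumn j b M′)) ⟨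
        Det M′ + - Det (addColumn j b M′) ∎

-- Labels, and transpositions of part numbers.

-- just s: the element lies in part number s; nothing: it lies in no part.
Label : Set
Label = Maybe ℕ

-- Whether the factor of an element labelled x contains the entries in the columns labelled y.
sees : Label → Label → Bool
sees nothing  nothing  = false
sees nothing  (just _) = true
sees (just s) nothing  = false
sees (just s) (just t) = s ≡ᵇ t

outside? : Label → Bool
outside? nothing  = true
outside? (just _) = false

fresh : ℕ → Label → Bool
fresh r nothing  = false
fresh r (just l) = r ≤ᵇ l

-- The transposition of `m` and `suc m`.
swap : ℕ → ℕ → ℕ
swap zero    zero          = 1
swap zero    (suc zero)    = 0
swap zero    (suc (suc l)) = suc (suc l)
swap (suc m) zero          = zero
swap (suc m) (suc l)       = suc (swap m l)

relabel : ℕ → Label → Label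
relabel m = Maybe.map (swap m)

swap-< : ∀ {m l} → l < m → swap m l ≡ l
swap-< {suc m} {zero}  _         = ≡.refl
swap-< {suc m} {suc l} (s≤s l<m) = ≡.cong suc (swap-< l<m)

-- Numbers above both transposed ones are written `d ℕ.+ suc (suc m)`, so that raising the number of
-- parts by one only replaces `d` by `suc d`.
swap-> : ∀ d m → swap m (d ℕ.+ suc (suc m)) ≡ d ℕ.+ suc (suc m)
swap-> d zero    rewrite ℕ.+-comm d 2 = ≡.refl
swap-> d (suc m) rewrite ℕ.+-suc d (suc (suc m)) = ≡.cong suc (swap-> d m)

swap-left : ∀ m → swap m m ≡ suc m
swap-left zero    = ≡.refl
swap-left (suc m) = ≡.cong suc (swap-left m)

swap-right : ∀ m → swap m (suc m) ≡ m
swap-right zero    = ≡.refl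
swap-right (suc m) = ≡.cong suc (swap-right m)

swap-≡ᵇ : ∀ m a b → (swap m a ≡ᵇ swap m b) ≡ (a ≡ᵇ b)
swap-≡ᵇ zero    zero          zero          = ≡.refl
swap-≡ᵇ zero    zero          (suc zero)    = ≡.refl
swap-≡ᵇ zero    zero          (suc (suc b)) = ≡.refl
swap-≡ᵇ zero    (suc zero)    zero          = ≡.refl
swap-≡ᵇ zero    (suc zero)    (suc zero)    = ≡.refl
swap-≡ᵇ zero    (suc zero)    (suc (suc b)) = ≡.refl
swap-≡ᵇ zero    (suc (suc a)) zero          = ≡.refl
swap-≡ᵇ zero    (suc (suc a)) (suc zero)    = ≡.refl
swap-≡ᵇ zero    (suc (suc a)) (suc (suc b)) = ≡.refl
swap-≡ᵇ (suc m) zero          zero          = ≡.refl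
swap-≡ᵇ (suc m) zero          (suc b)       = ≡.refl
swap-≡ᵇ (suc m) (suc a)       zero          = ≡.refl
swap-≡ᵇ (suc m) (suc a)       (suc b)       = swap-≡ᵇ m a b

swap-≥ : ∀ {r m l} → r ≤ m → r ≤ l → r ≤ swap m l
swap-≥ z≤n       _         = z≤n
swap-≥ (s≤s r≤m) (s≤s r≤l) = s≤s (swap-≥ r≤m r≤l)

sees-relabel : ∀ m x y → sees (relabel m x) (relabel m y) ≡ sees x y
sees-relabel m nothing  nothing  = ≡.refl
sees-relabel m nothing  (just _) = ≡.refl
sees-relabel m (just _) nothing  = ≡.refl
sees-relabel m (just a) (just b) = swap-≡ᵇ m a b

≡ᵇ-refl : ∀ n → (n ≡ᵇ n) ≡ true
≡ᵇ-refl zero    = ≡.refl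
≡ᵇ-refl (suc n) = ≡ᵇ-refl n

≤ᵇ-suc : ∀ m n → (suc m ≤ᵇ suc n) ≡ (m ≤ᵇ n)
≤ᵇ-suc zero    n = ≡.refl
≤ᵇ-suc (suc m) n = ≡.refl

≤ᵇ-refl : ∀ n → (n ≤ᵇ n) ≡ true
≤ᵇ-refl zero    = ≡.refl
≤ᵇ-refl (suc n) = ≡.trans (≤ᵇ-suc n n) (≤ᵇ-refl n)

<⇒≡ᵇ : ∀ {m n} → m < n → (n ≡ᵇ m) ≡ false
<⇒≡ᵇ {zero}  (s≤s _)   = ≡.refl
<⇒≡ᵇ {suc m} (s≤s m<n) = <⇒≡ᵇ m<n

<⇒≤ᵇ : ∀ {m n} → m < n → (n ≤ᵇ m) ≡ false
<⇒≤ᵇ {zero}          (s≤s _)   = ≡.refl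
<⇒≤ᵇ {suc m} {suc n} (s≤s m<n) = ≡.trans (≤ᵇ-suc n m) (<⇒≤ᵇ m<n)

n≡ᵇ1+n : ∀ n → (n ≡ᵇ suc n) ≡ false
n≡ᵇ1+n zero    = ≡.refl
n≡ᵇ1+n (suc n) = n≡ᵇ1+n n

sees-just : ∀ s x → sees (just s) x ≡ true → x ≡ just s
sees-just s (just l) eq = ≡.cong just (≡.sym (ℕ.≡ᵇ⇒≡ s l (≡.subst T (≡.sym eq) tt)))

-- Under this bound on the part numbers, `decode χ k` never reaches the junk case of `extendAt`.
data Bounded (k : ℕ) : ∀ {n} → Vec Label n → Set where
  []   : Bounded k []
  out  : ∀ {n} {χ : Vec Label n} → Bounded k χ → Bounded k (nothing ∷ χ)
  into : ∀ {n s} {χ : Vec Label n} → s < k → Bounded k χ → Bounded k (just s ∷ χ)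

-- Sums over label vectors.

module Growth {c ℓ} (R : CommutativeRing c ℓ) where
  open Summation R

  -- The last term is split off because the part with the highest number is the newest.
  ∑< : ℕ → (ℕ → Carrier) → Carrier
  ∑< zero    f = 0#
  ∑< (suc r) f = ∑< r f + f r

  ∑<-cong : ∀ r {f g : ℕ → Carrier} → (∀ s → s < r → f s ≈ g s) → ∑< r f ≈ ∑< r g
  ∑<-cong zero    h = refl
  ∑<-cong (suc r) h = +-cong (∑<-cong r (λ s s<r → h s (ℕ.m≤n⇒m≤1+n s<r))) (h r ℕ.≤-refl)

  ∑<-0 : ∀ r → ∑< r (λ _ → 0#) ≈ 0#
  ∑<-0 zero    = refl
  ∑<-0 (suc r) = trans (+-identityʳ _) (∑<-0 r)

  ∑<-+ : ∀ r f g → ∑< r (λ s → f s + g s) ≈ ∑< r f + ∑< r g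
  ∑<-+ zero    f g = sym (+-identityˡ 0#)
  ∑<-+ (suc r) f g = trans (+-congʳ (∑<-+ r f g)) (+-interchange _ _ _ _)

  ∑<-*ˡ : ∀ r a f → ∑< r (λ s → a * f s) ≈ a * ∑< r f
  ∑<-*ˡ zero    a f = sym (zeroʳ a)
  ∑<-*ˡ (suc r) a f = trans (+-congʳ (∑<-*ˡ r a f)) (sym (distribˡ a _ _))

  ∑<-*ʳ : ∀ r f a → ∑< r (λ s → f s * a) ≈ ∑< r f * a
  ∑<-*ʳ zero    f a = sym (zeroˡ a)
  ∑<-*ʳ (suc r) f a = trans (+-congʳ (∑<-*ʳ r f a)) (sym (distribʳ a _ _))

  ∑<-∑ : ∀ r {n} (f : ℕ → Fin n → Carrier) → ∑< r (λ s → ∑ (f s)) ≈ ∑ (λ j → ∑< r (λ s → f s j))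
  ∑<-∑ zero    f = sym ∑-0
  ∑<-∑ (suc r) f = trans (+-congʳ (∑<-∑ r f)) (sym (∑-+ _ _))

  ∑<-const : ∀ r a → ∑< r (λ _ → a) ≈ natCast R r * a
  ∑<-const zero    a = sym (zeroˡ a)
  ∑<-const (suc r) a = begin
    ∑< r (λ _ → a) + a       ≈⟨ +-cong (∑<-const r a) (sym (*-identityˡ a)) ⟩
    natCast R r * a + 1# * a ≈⟨ +-comm _ _ ⟩
    1# * a + natCast R r * a ≈⟨ distribʳ a _ _ ⟨
    (1# + natCast R r) * a   ∎

  ∑<-swap : ∀ d m f → ∑< (d ℕ.+ suc (suc m)) f ≈ ∑< (d ℕ.+ suc (suc m)) (λ s → f (swap m s))
  ∑<-swap zero m f = begin
    (∑< m f + f m) + f (suc m)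
      ≈⟨ +-assoc _ _ _ ⟩
    ∑< m f + (f m + f (suc m))
      ≈⟨ +-congˡ (+-comm _ _) ⟩
    ∑< m f + (f (suc m) + f m)
      ≈⟨ +-assoc _ _ _ ⟨
    (∑< m f + f (suc m)) + f m
      ≈⟨ +-cong (+-cong (∑<-cong m (λ s s<m → reflexive (≡.cong f (≡.sym (swap-< s<m)))))
           (reflexive (≡.cong f (≡.sym (swap-left m)))))
           (reflexive (≡.cong f (≡.sym (swap-right m)))) ⟩
    (∑< m (λ s → f (swap m s)) + f (swap m m)) + f (swap m (suc m)) ∎
  ∑<-swap (suc d) m f = +-cong (∑<-swap d m f) (reflexive (≡.cong f (≡.sym (swap-> d m))))

  -- Sum over the label vectors in which the parts 0, …, r − 1 exist beforehand and
  -- further parts are numbered by first occurrence; φ also receives the number of parts.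
  G : ℕ → (n : ℕ) → (Vec Label n → ℕ → Carrier) → Carrier
  G r zero    φ = φ [] r
  G r (suc n) φ = G r n (λ χ → φ (nothing ∷ χ))
    + (∑< r (λ s → G r n (λ χ → φ (just s ∷ χ))) + G (suc r) n (λ χ → φ (just r ∷ χ)))

  -- The number of parts never decreases along the recursion of `G`, so every label chosen on the
  -- way is below the final number `k`, and agreement is needed on such vectors only.
  G-cong-bounded : ∀ r n {φ ψ : Vec Label n → ℕ → Carrier} →
    (∀ χ k → r ≤ k → Bounded k χ → φ χ k ≈ ψ χ k) → G r n φ ≈ G r n ψ
  G-cong-bounded r zero    h = h [] r ℕ.≤-refl []
  G-cong-bounded r (suc n) h = +-cong
    (G-cong-bounded r n (λ χ k r≤k b → h _ k r≤k (out b)))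
    (+-cong
      (∑<-cong r (λ s s<r → G-cong-bounded r n (λ χ k r≤k b → h _ k r≤k (into (ℕ.≤-trans s<r r≤k) b))))
      (G-cong-bounded (suc r) n (λ χ k r<k b → h _ k (ℕ.<⇒≤ r<k) (into r<k b))))

  G-cong : ∀ r n {φ ψ : Vec Label n → ℕ → Carrier} → (∀ χ k → φ χ k ≈ ψ χ k) → G r n φ ≈ G r n ψ
  G-cong r n h = G-cong-bounded r n (λ χ k _ _ → h χ k)

  G-0 : ∀ r n → G r n (λ _ _ → 0#) ≈ 0#
  G-0 r zero    = refl
  G-0 r (suc n) = begin
    _ ≈⟨ +-cong (G-0 r n) (+-cong (trans (∑<-cong r (λ _ _ → G-0 r n)) (∑<-0 r)) (G-0 (suc r) n)) ⟩
    0# + (0# + 0#) ≈⟨ trans (+-identityˡ _) (+-identityˡ _) ⟩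
    0# ∎

  G-+ : ∀ r n (φ ψ : Vec Label n → ℕ → Carrier) → G r n (λ χ k → φ χ k + ψ χ k) ≈ G r n φ + G r n ψ
  G-+ r zero    φ ψ = refl
  G-+ r (suc n) φ ψ = begin
    _ ≈⟨ +-cong (G-+ r n _ _) (+-cong (trans (∑<-cong r (λ _ _ → G-+ r n _ _)) (∑<-+ r _ _)) (G-+ (suc r) n _ _)) ⟩
    _ ≈⟨ +-congˡ (+-interchange _ _ _ _) ⟩
    _ ≈⟨ +-interchange _ _ _ _ ⟩
    _ ∎

  G-*ˡ : ∀ r n a (φ : Vec Label n → ℕ → Carrier) → G r n (λ χ k → a * φ χ k) ≈ a * G r n φ
  G-*ˡ r zero    a φ = refl
  G-*ˡ r (suc n) a φ = begin
    _ ≈⟨ +-cong (G-*ˡ r n a _) (+-cong (trans (∑<-cong r (λ _ _ → G-*ˡ r n a _)) (∑<-*ˡ r a _)) (G-*ˡ (suc r) n a _)) ⟩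
    _ ≈⟨ +-congˡ (sym (distribˡ a _ _)) ⟩
    _ ≈⟨ distribˡ a _ _ ⟨
    _ ∎

  G-∑ : ∀ r n {m} (φ : Fin m → Vec Label n → ℕ → Carrier) →
    G r n (λ χ k → ∑ (λ j → φ j χ k)) ≈ ∑ (λ j → G r n (φ j))
  G-∑ r zero    φ = refl
  G-∑ r (suc n) φ = begin
    _ ≈⟨ +-cong (G-∑ r n _) (+-cong (trans (∑<-cong r (λ _ _ → G-∑ r n _)) (∑<-∑ r _)) (G-∑ (suc r) n _)) ⟩
    _ ≈⟨ +-congˡ (sym (∑-+ _ _)) ⟩
    _ ≈⟨ ∑-+ _ _ ⟨
    _ ∎

  G-∑< : ∀ r n t (φ : ℕ → Vec Label n → ℕ → Carrier) →
    G r n (λ χ k → ∑< t (λ s → φ s χ k)) ≈ ∑< t (λ s → G r n (φ s))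
  G-∑< r n zero    φ = G-0 r n
  G-∑< r n (suc t) φ = trans (G-+ r n _ _) (+-congʳ (G-∑< r n t φ))

  -- Both transposed numbers belong to parts that exist beforehand. The recursion treats these parts
  -- alike, and the numbers of parts opened later are fixed by the transposition.
  G-swap : ∀ d m n (φ : Vec Label n → ℕ → Carrier) → let r = d ℕ.+ suc (suc m) in
    G r n φ ≈ G r n (λ χ → φ (map (relabel m) χ))
  G-swap d m zero    φ = refl
  G-swap d m (suc n) φ = +-cong (G-swap d m n _) (+-cong
    (trans (∑<-swap d m (λ s → G _ n (λ χ → φ (just s ∷ χ)))) (∑<-cong (d ℕ.+ suc (suc m)) (λ s _ → G-swap d m n _)))
    (trans (G-swap (suc d) m n _) (reflexive
      (≡.cong (λ s → G (suc d ℕ.+ suc (suc m)) n (λ χ → φ (just s ∷ map (relabel m) χ))) (≡.sym (swap-> d m))))))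

  -- The value does not depend on how the parts from number `r` on are numbered. Transpositions of
  -- neighbours are enough for `G-fresh`, which renames the part of `j` one step at a time.
  Invariant : ∀ {n} → ℕ → (Vec Label n → ℕ → Carrier) → Set ℓ
  Invariant r φ = ∀ m → r ≤ m → ∀ χ k → φ (map (relabel m) χ) k ≈ φ χ k

  Invariant-nothing : ∀ {n r} {φ : Vec Label (suc n) → ℕ → Carrier} →
    Invariant r φ → Invariant r (λ χ → φ (nothing ∷ χ))
  Invariant-nothing inv m r≤m χ = inv m r≤m (nothing ∷ χ)

  Invariant-just : ∀ {n r s} {φ : Vec Label (suc n) → ℕ → Carrier} →
    Invariant r φ → s < r → Invariant r (λ χ → φ (just s ∷ χ))
  Invariant-just {s = s} {φ} inv s<r m r≤m χ k = trans
    (reflexive (≡.cong (λ t → φ (just t ∷ map (relabel m) χ) k) (≡.sym (swap-< (ℕ.≤-trans s<r r≤m)))))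
    (inv m r≤m (just s ∷ χ) k)

  Invariant-suc : ∀ {n r} {φ : Vec Label n → ℕ → Carrier} → Invariant r φ → Invariant (suc r) φ
  Invariant-suc inv m r<m = inv m (ℕ.<⇒≤ r<m)

  [≤]-split : ∀ r l → [ r ≤ᵇ l ] ≈ [ r ≡ᵇ l ] + [ suc r ≤ᵇ l ]
  [≤]-split zero    zero    = sym (+-identityʳ 1#)
  [≤]-split zero    (suc l) = sym (+-identityˡ 1#)
  [≤]-split (suc r) zero    = sym (+-identityʳ 0#)
  [≤]-split (suc r) (suc l) = trans (reflexive (≡.cong [_] (≤ᵇ-suc r l))) ([≤]-split r l)

  [fresh]-split : ∀ r x → [ fresh r x ] ≈ [ sees (just r) x ] + [ fresh (suc r) x ]
  [fresh]-split r nothing  = sym (+-identityʳ 0#)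
  [fresh]-split r (just l) = [≤]-split r l

  [false]* : ∀ {b} x → b ≡ false → [ b ] * x ≈ 0#
  [false]* x ≡.refl = zeroˡ x

  [true]* : ∀ {b} x → b ≡ true → [ b ] * x ≈ x
  [true]* x ≡.refl = *-identityˡ x

  -- The part of j, if not among the first r, may be taken to be part number r.
  G-fresh : ∀ r n (j : Fin n) (φ : Vec Label n → ℕ → Carrier) → Invariant r φ →
    G r n (λ χ k → [ fresh r (lookup χ j) ] * φ χ k)
      ≈ G (suc r) n (λ χ k → [ sees (just r) (lookup χ j) ] * φ χ k)
  G-fresh r (suc n) zero φ inv = begin
    -- Here `j` is the first element. On the left only the term in which it opens part `r` survives,
    -- on the right only the one in which it joins the existing part `r`; both are `X`.
    _ ≈⟨ +-cong (zeros r (λ χ k → zeroˡ _)) (+-cong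
           (zeros< (λ s s<r → zeros r (λ χ k → [false]* _ (<⇒≤ᵇ s<r))))
           (G-cong (suc r) n (λ χ k → [true]* _ (≤ᵇ-refl r)))) ⟩
    0# + (0# + X)
      ≈⟨ +-congˡ (+-identityʳ _) ⟨
    0# + ((0# + X) + 0#)
      ≈⟨ +-cong (zeros (suc r) (λ χ k → zeroˡ _)) (+-cong (+-cong
           (zeros< (λ s s<r → zeros (suc r) (λ χ k → [false]* _ (<⇒≡ᵇ s<r))))
           (G-cong (suc r) n (λ χ k → [true]* _ (≡ᵇ-refl r))))
           (zeros (suc (suc r)) (λ χ k → [false]* _ (n≡ᵇ1+n r)))) ⟨
    _ ∎
    where
    X = G (suc r) n (λ χ → φ (just r ∷ χ))

    zeros : ∀ t {ψ : Vec Label n → ℕ → Carrier} → (∀ χ k → ψ χ k ≈ 0#) → G t n ψ ≈ 0#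
    zeros t h = trans (G-cong t n h) (G-0 t n)

    zeros< : ∀ {f} → (∀ s → s < r → f s ≈ 0#) → ∑< r f ≈ 0#
    zeros< h = trans (∑<-cong r h) (∑<-0 r)
  G-fresh r (suc n) (suc j) φ inv = begin
    _ ≈⟨ +-cong (G-fresh r n j _ (Invariant-nothing {φ = φ} inv)) (+-cong
           (∑<-cong r (λ s s<r → G-fresh r n j _ (Invariant-just {φ = φ} inv s<r)))
           new) ⟩
    _ ≈⟨ +-congˡ (sym (+-assoc _ _ _)) ⟩
    _ ∎
    where
    φ₀ φ₁ : Vec Label n → ℕ → Carrier
    φ₀ χ = φ (just r ∷ χ)
    φ₁ χ = φ (just (suc r) ∷ χ)

    -- The part `r` of the first element and the part `suc r` of `j` trade numbers.
    exchange : ∀ χ k → [ sees (just r) (lookup (map (relabel r) χ) j) ] * φ₁ (map (relabel r) χ) k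
                         ≈ [ sees (just (suc r)) (lookup χ j) ] * φ₀ χ k
    exchange χ k = *-cong
      (reflexive (≡.cong [_] (≡.trans
        (≡.cong₂ (λ s → sees (just s)) (≡.sym (swap-right r)) (lookup-map j (relabel r) χ))
        (sees-relabel r (just (suc r)) (lookup χ j)))))
      (trans (reflexive (≡.cong (λ t → φ (just t ∷ map (relabel r) χ) k) (≡.sym (swap-left r))))
             (inv r ℕ.≤-refl (just r ∷ χ) k))

    -- The first element has opened part `r`. Either `j` lies in it too, or the part of `j` is newer
    -- and by induction has number `suc r`; the exchange gives it number `r` again.
    new : G (suc r) n (λ χ k → [ fresh r (lookup χ j) ] * φ₀ χ k)
      ≈ G (suc r) n (λ χ k → [ sees (just r) (lookup χ j) ] * φ₀ χ k)
        + G (suc (suc r)) n (λ χ k → [ sees (just r) (lookup χ j) ] * φ₁ χ k)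
    new = begin
      _ ≈⟨ G-cong (suc r) n (λ χ k → trans (*-congʳ ([fresh]-split r (lookup χ j))) (distribʳ _ _ _)) ⟩
      _ ≈⟨ G-+ (suc r) n _ _ ⟩
      _ ≈⟨ +-congˡ (G-fresh (suc r) n j φ₀ (Invariant-just {φ = φ} (Invariant-suc {φ = φ} inv) ℕ.≤-refl)) ⟩
      _ ≈⟨ +-congˡ (G-cong (suc (suc r)) n exchange) ⟨
      _ ≈⟨ +-congˡ (G-swap 0 r n (λ χ k → [ sees (just r) (lookup χ j) ] * φ₁ χ k)) ⟨
      _ ∎

-- Weights of label vectors, and their sum as a determinant.

module Expansion {c ℓ} (R : CommutativeRing c ℓ) where
  open Summation R
  open Determinant R
  open Growth R

  natCast-+ : ∀ m n → natCast R (m ℕ.+ n) ≈ natCast R m + natCast R n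
  natCast-+ zero    n = sym (+-identityˡ _)
  natCast-+ (suc m) n = trans (+-congˡ (natCast-+ m n)) (sym (+-assoc _ _ _))

  natCast-* : ∀ m n → natCast R (m ℕ.* n) ≈ natCast R m * natCast R n
  natCast-* zero    n = sym (zeroˡ _)
  natCast-* (suc m) n = begin
    natCast R (n ℕ.+ m ℕ.* n)                      ≈⟨ natCast-+ n (m ℕ.* n) ⟩
    natCast R n + natCast R (m ℕ.* n)              ≈⟨ +-cong (sym (*-identityˡ _)) (natCast-* m n) ⟩
    1# * natCast R n + natCast R m * natCast R n   ≈⟨ distribʳ _ _ _ ⟨
    (1# + natCast R m) * natCast R n               ∎

  κ : ℕ → Carrier
  κ k = neg1^ R k * natCast R (k !)

  κ-suc : ∀ r → κ (suc r) ≈ - 1# * ((1# + natCast R r) * κ r)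
  κ-suc r = begin
    - neg1^ R r * natCast R (suc r ℕ.* r !)
      ≈⟨ *-congˡ (natCast-* (suc r) (r !)) ⟩
    - neg1^ R r * ((1# + natCast R r) * natCast R (r !))
      ≈⟨ *-congʳ (sym (-1*x≈-x _)) ⟩
    (- 1# * neg1^ R r) * ((1# + natCast R r) * natCast R (r !))
      ≈⟨ trans (*-assoc _ _ _) (*-congˡ (*-leftComm _ _ _)) ⟩
    - 1# * ((1# + natCast R r) * κ r) ∎

  -- For disjoint parts, `sgn` is -1 for each part times -1 for each covered element; the first sign
  -- is in `κ`, the second is this one.
  σ : Label → Carrier
  σ nothing  = 1#
  σ (just _) = - 1#

  -- `D i x` collects what the factor of `i`, if labelled `x`, receives from the diagonal and from
  -- the elements already removed; `B` holds the entries in the columns of the remaining ones.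
  linear : ∀ {n} → (Fin n → Label → Carrier) → Matrix n → Vec Label n → Fin n → Carrier
  linear D B χ i = D i (lookup χ i) + ∑ (λ j → [ sees (lookup χ i) (lookup χ j) ] * B i j)

  weight : ∀ {n} → (Fin n → Label → Carrier) → Matrix n → Vec Label n → ℕ → Carrier
  weight D B χ k = κ k * ∏ (λ i → σ (lookup χ i) * linear D B χ i)

  weight-cong : ∀ {n} {D D′ : Fin n → Label → Carrier} {B B′ : Matrix n} {χ χ′} k →
    (∀ i → σ (lookup χ i) ≈ σ (lookup χ′ i)) →
    (∀ i → linear D B χ i ≈ linear D′ B′ χ′ i) → weight D B χ k ≈ weight D′ B′ χ′ k
  weight-cong k g h = *-congˡ (∏-cong (λ i → *-cong (g i) (h i)))

  -- The contribution of a new element with label l and column b.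
  extend : ∀ {n} → Label → (Fin n → Carrier) → (Fin n → Label → Carrier) → Fin n → Label → Carrier
  extend l b D i x = D i x + [ sees x l ] * b i

  -- For `s < r`, the values `D i (just s)` form the column c s of part `s`. An uncovered element
  -- receives its own `d i` and all these columns, and a part not yet opened contributes nothing.
  record Balanced {n} (r : ℕ) (d : Fin n → Carrier) (D : Fin n → Label → Carrier) : Set ℓ where
    field
      out-sum : ∀ i → D i nothing ≈ d i + ∑< r (λ s → D i (just s))
      vanish  : ∀ i l → r ≤ l → D i (just l) ≈ 0#
  open Balanced

  ∑<-[≡] : ∀ r l → ∑< r (λ s → [ s ≡ᵇ l ]) + [ r ≤ᵇ l ] ≈ 1#
  ∑<-[≡] zero    l = +-identityˡ 1#
  ∑<-[≡] (suc r) l = begin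
    (∑< r (λ s → [ s ≡ᵇ l ]) + [ r ≡ᵇ l ]) + [ suc r ≤ᵇ l ]  ≈⟨ +-assoc _ _ _ ⟩
    ∑< r (λ s → [ s ≡ᵇ l ]) + ([ r ≡ᵇ l ] + [ suc r ≤ᵇ l ])  ≈⟨ +-congˡ ([≤]-split r l) ⟨
    ∑< r (λ s → [ s ≡ᵇ l ]) + [ r ≤ᵇ l ]                      ≈⟨ ∑<-[≡] r l ⟩
    1#                                                          ∎

  ∑<-[≡]-< : ∀ {r l} → l < r → ∑< r (λ s → [ s ≡ᵇ l ]) ≈ 1#
  ∑<-[≡]-< {r} {l} l<r = begin
    ∑< r (λ s → [ s ≡ᵇ l ])               ≈⟨ +-identityʳ _ ⟨
    ∑< r (λ s → [ s ≡ᵇ l ]) + 0#          ≡⟨ ≡.cong (λ b → ∑< r (λ s → [ s ≡ᵇ l ]) + [ b ]) (<⇒≤ᵇ l<r) ⟨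
    ∑< r (λ s → [ s ≡ᵇ l ]) + [ r ≤ᵇ l ]  ≈⟨ ∑<-[≡] r l ⟩
    1#                                    ∎

  Balanced-tail : ∀ {n r d} {D : Fin (suc n) → Label → Carrier} →
    Balanced r d D → Balanced r (λ i → d (suc i)) (λ i → D (suc i))
  Balanced-tail bal = record { out-sum = λ i → out-sum bal (suc i) ; vanish = λ i → vanish bal (suc i) }

  -- Part `r` joins the existing parts with the zero column.
  Balanced-suc : ∀ {n r d} {D : Fin n → Label → Carrier} → Balanced r d D → Balanced (suc r) d D
  Balanced-suc {r = r} bal = record
    { out-sum = λ i → trans (out-sum bal i)
        (+-congˡ (trans (sym (+-identityʳ _)) (+-congˡ (sym (vanish bal i r ℕ.≤-refl)))))
    ; vanish  = λ i l r<l → vanish bal i l (ℕ.<⇒≤ r<l) }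

  Balanced-nothing : ∀ {n r d b} {D : Fin n → Label → Carrier} →
    Balanced r d D → Balanced r d (extend nothing b D)
  Balanced-nothing {r = r} {D = D} bal = record
    { out-sum = λ i → trans (same i) (trans (out-sum bal i)
        (+-congˡ (∑<-cong r (λ s _ → sym (same i)))))
    ; vanish  = λ i l r≤l → trans (same i) (vanish bal i l r≤l) }
    where
    same : ∀ i {x b} → x + 0# * b ≈ x
    same i = trans (+-congˡ (zeroˡ _)) (+-identityʳ _)

  -- An element that joins part `s` is seen by the members of that part and by the uncovered
  -- elements, so both sides of `out-sum` grow by `b i`.
  Balanced-just : ∀ {n r d b s} {D : Fin n → Label → Carrier} → s < r →
    Balanced r d D → Balanced r d (extend (just s) b D)
  Balanced-just {r = r} {d} {b} {s} {D} s<r bal = record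
    { out-sum = λ i → begin
        D i nothing + 1# * b i
          ≈⟨ +-cong (out-sum bal i) (*-congʳ (sym (∑<-[≡]-< s<r))) ⟩
        (d i + ∑< r (λ t → D i (just t))) + ∑< r (λ t → [ t ≡ᵇ s ]) * b i
          ≈⟨ +-assoc _ _ _ ⟩
        d i + (∑< r (λ t → D i (just t)) + ∑< r (λ t → [ t ≡ᵇ s ]) * b i)
          ≈⟨ +-congˡ (+-congˡ (∑<-*ʳ r _ (b i))) ⟨
        d i + (∑< r (λ t → D i (just t)) + ∑< r (λ t → [ t ≡ᵇ s ] * b i))
          ≈⟨ +-congˡ (∑<-+ r _ _) ⟨
        d i + ∑< r (λ t → D i (just t) + [ t ≡ᵇ s ] * b i) ∎
    ; vanish  = λ i l r≤l → trans (+-cong (vanish bal i l r≤l) ([false]* (b i) (<⇒≡ᵇ (ℕ.≤-trans s<r r≤l))))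
                                  (+-identityʳ 0#) }

  Balanced-relabel : ∀ {n r d} {D : Fin n → Label → Carrier} → Balanced r d D →
    ∀ m → r ≤ m → ∀ i x → D i (relabel m x) ≈ D i x
  Balanced-relabel         bal m r≤m i nothing  = refl
  Balanced-relabel {r = r} {D = D} bal m r≤m i (just l) with r ℕ.≤? l
  ... | yes r≤l = trans (vanish bal i _ (swap-≥ r≤m r≤l)) (sym (vanish bal i l r≤l))
  ... | no  r≰l = reflexive (≡.cong (λ t → D i (just t)) (swap-< (ℕ.≤-trans (ℕ.≰⇒> r≰l) r≤m)))

  -- Renumbering preserves which labels coincide, hence `sees` and `σ`, and `D` vanishes on the part
  -- numbers that move.
  weight-invariant : ∀ {n r d} {D : Fin n → Label → Carrier} (B : Matrix n) →
    Balanced r d D → Invariant r (weight D B)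
  weight-invariant {D = D} B bal m r≤m χ k = weight-cong {D = D} {D} {B} {B} {map (relabel m) χ} {χ} k
    (λ i → trans (reflexive (≡.cong σ (lookup-map i _ χ))) (σ-relabel (lookup χ i)))
    (λ i → +-cong
      (trans (reflexive (≡.cong (D i) (lookup-map i _ χ))) (Balanced-relabel bal m r≤m i (lookup χ i)))
      (∑-cong (λ j → *-congʳ (reflexive (≡.cong [_] (≡.trans
        (≡.cong₂ sees (lookup-map i _ χ) (lookup-map j _ χ))
        (sees-relabel m (lookup χ i) (lookup χ j))))))))
    where
    σ-relabel : ∀ x → σ (relabel m x) ≈ σ x
    σ-relabel nothing  = refl
    σ-relabel (just _) = refl

  ∑-pick : ∀ {n} (j : Fin n) (f : Fin n → Carrier) → ∑ (λ k → [ does (j ≟ k) ] * f k) ≈ f j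
  ∑-pick {suc n} j f = begin
    ∑ (λ k → [ does (j ≟ k) ] * f k)
      ≈⟨ ∑-punchIn j _ ⟩
    [ does (j ≟ j) ] * f j + ∑ (λ k → [ does (j ≟ punchIn j k) ] * f (punchIn j k))
      ≈⟨ +-cong ([true]* (f j) (≟-refl j)) (trans (∑-cong (λ k → [false]* _ (≟-punchIn j k))) ∑-0) ⟩
    f j + 0#
      ≈⟨ +-identityʳ _ ⟩
    f j ∎

  -- Column `j` enters a factor exactly when that factor sees the label of `j`, so the added column
  -- acts like the column of a further element in the position of `j`.
  weight-addColumn : ∀ {n} (D : Fin n → Label → Carrier) (B : Matrix n) b j χ k →
    weight D (addColumn j b B) χ k ≈ weight (extend (lookup χ j) b D) B χ k
  weight-addColumn D B b j χ k = weight-cong {D = D} {extend (lookup χ j) b D} {χ = χ} {χ} k (λ i → refl) λ i →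
    let x = lookup χ i in begin
    D i x + ∑ (λ t → [ sees x (lookup χ t) ] * (B i t + [ does (j ≟ t) ] * b i))
      ≈⟨ +-congˡ (trans (∑-cong (λ t → trans (distribˡ _ _ _) (+-congˡ (*-leftComm _ _ _)))) (∑-+ _ _)) ⟩
    D i x + (∑ (λ t → [ sees x (lookup χ t) ] * B i t)
      + ∑ (λ t → [ does (j ≟ t) ] * ([ sees x (lookup χ t) ] * b i)))
      ≈⟨ +-congˡ (trans (+-congˡ (∑-pick j _)) (+-comm _ _)) ⟩
    D i x + ([ sees x (lookup χ j) ] * b i + ∑ (λ t → [ sees x (lookup χ t) ] * B i t))
      ≈⟨ +-assoc _ _ _ ⟨
    (D i x + [ sees x (lookup χ j) ] * b i) + ∑ (λ t → [ sees x (lookup χ t) ] * B i t) ∎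

  -- Column 0 of `B` moves into `D`, and the factor of the first element is opened up as a linear
  -- form in row 0.
  weight-∷ : ∀ {n} (D : Fin (suc n) → Label → Carrier) (B : Matrix (suc n)) l χ k →
    let W = weight (extend l (λ i → B (suc i) zero) (λ i → D (suc i))) (minor zero zero B) χ k in
    weight D B (l ∷ χ) k ≈ σ l * ((D zero l + [ sees l l ] * B zero zero) * W
                                  + ∑ (λ j → B zero (suc j) * ([ sees l (lookup χ j) ] * W)))
  weight-∷ {n} D B l χ k = begin
    κ k * ((σ l * (D zero l + ∑ (λ j → [ sees l (lookup (l ∷ χ) j) ] * B zero j)))
      * ∏ (λ i → σ (lookup χ i) * linear D B (l ∷ χ) (suc i)))
      ≈⟨ *-congˡ (*-cong (*-congˡ (+-congˡ (reflexive (∑-suc _)))) (∏-cong {n} (λ i → *-congˡ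
           (trans (+-congˡ (reflexive (∑-suc _))) (sym (+-assoc _ _ _)))))) ⟩
    κ k * ((σ l * (D zero l + ([ sees l l ] * B zero zero + S))) * P)
      ≈⟨ solve 6 (λ κ σ D e S P → κ :* ((σ :* (D :+ (e :+ S))) :* P)
           := σ :* ((D :+ e) :* (κ :* P) :+ S :* (κ :* P))) refl (κ k) (σ l) _ _ S P ⟩
    σ l * ((D zero l + [ sees l l ] * B zero zero) * (κ k * P) + S * (κ k * P))
      ≈⟨ *-congˡ (+-congˡ (sym (∑-*ʳ _ _))) ⟩
    σ l * ((D zero l + [ sees l l ] * B zero zero) * (κ k * P)
      + ∑ (λ j → ([ sees l (lookup χ j) ] * B zero (suc j)) * (κ k * P)))
      ≈⟨ *-congˡ (+-congˡ (∑-cong (λ j → trans (*-congʳ (*-comm _ _)) (*-assoc _ _ _)))) ⟩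
    _ ∎
    where
    S = ∑ (λ j → [ sees l (lookup χ j) ] * B zero (suc j))
    P = ∏ (λ i → σ (lookup χ i) * linear (extend l (λ i → B (suc i) zero) (λ i → D (suc i))) (minor zero zero B) χ i)

  addDiagonal : ∀ {n} → (Fin n → Carrier) → Matrix n → Matrix n
  addDiagonal d B i j = B i j + [ does (i ≟ j) ] * d i

  [label]-split : ∀ r x → 1# ≈ [ outside? x ] + (∑< r (λ s → [ sees (just s) x ]) + [ fresh r x ])
  [label]-split r nothing  = sym (trans (+-congˡ (trans (+-identityʳ _) (∑<-0 r))) (+-identityʳ 1#))
  [label]-split r (just l) = sym (trans (+-identityˡ _) (∑<-[≡] r l))

  -- Merging the new element (with column b) into j: the terms are sorted by the label of j.
  G-addColumn : ∀ {n} r (d : Fin n → Carrier) (D : Fin n → Label → Carrier) (B : Matrix n) b j →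
    Balanced r d D →
    G r n (weight D (addColumn j b B))
      ≈ G r n (λ χ k → [ outside? (lookup χ j) ] * weight (extend nothing b D) B χ k)
        + (∑< r (λ s → G r n (λ χ k → [ sees (just s) (lookup χ j) ] * weight (extend (just s) b D) B χ k))
          + G (suc r) n (λ χ k → [ sees (just r) (lookup χ j) ] * weight (extend (just r) b D) B χ k))
  G-addColumn {n} r d D B b j bal = begin
    G r n w
      ≈⟨ G-cong r n split ⟩
    G r n (λ χ k → [ outside? (lookup χ j) ] * w χ k
      + (∑< r (λ s → [ sees (just s) (lookup χ j) ] * w χ k) + [ fresh r (lookup χ j) ] * w χ k))
      ≈⟨ trans (G-+ r n _ _) (+-congˡ (trans (G-+ r n _ _) (+-congʳ (G-∑< r n r _)))) ⟩
    G r n (λ χ k → [ outside? (lookup χ j) ] * w χ k)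
      + (∑< r (λ s → G r n (λ χ k → [ sees (just s) (lookup χ j) ] * w χ k))
        + G r n (λ χ k → [ fresh r (lookup χ j) ] * w χ k))
      -- This has to come before the column `b` is moved into `D`: at this point `D` is still
      -- balanced for `r`, which makes `w` invariant.
      ≈⟨ +-congˡ (+-congˡ (G-fresh r n j w (weight-invariant (addColumn j b B) bal))) ⟩
    G r n (λ χ k → [ outside? (lookup χ j) ] * w χ k)
      + (∑< r (λ s → G r n (λ χ k → [ sees (just s) (lookup χ j) ] * w χ k))
        + G (suc r) n (λ χ k → [ sees (just r) (lookup χ j) ] * w χ k))
      ≈⟨ +-cong (G-cong r n at-nothing)
           (+-cong (∑<-cong r (λ s _ → G-cong r n (at-just s))) (G-cong (suc r) n (at-just r))) ⟩
    _ ∎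
    where
    w : Vec Label n → ℕ → Carrier
    w = weight D (addColumn j b B)

    split : ∀ χ k → w χ k ≈ [ outside? (lookup χ j) ] * w χ k
      + (∑< r (λ s → [ sees (just s) (lookup χ j) ] * w χ k) + [ fresh r (lookup χ j) ] * w χ k)
    split χ k = begin
      w χ k       ≈⟨ *-identityˡ _ ⟨
      1# * w χ k  ≈⟨ *-congʳ ([label]-split r (lookup χ j)) ⟩
      _           ≈⟨ distribʳ _ _ _ ⟩
      _           ≈⟨ +-congˡ (distribʳ _ _ _) ⟩
      _           ≈⟨ +-congˡ (+-congʳ (∑<-*ʳ r _ _)) ⟨
      _           ∎

    guarded : ∀ {c} l χ k → (c ≡ true → lookup χ j ≡ l) →
      [ c ] * w χ k ≈ [ c ] * weight (extend l b D) B χ k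
    guarded {false} l χ k h = trans (zeroˡ _) (sym (zeroˡ _))
    guarded {true}  l χ k h = *-congˡ (trans (weight-addColumn D B b j χ k)
      (reflexive (≡.cong (λ x → weight (extend x b D) B χ k) (h ≡.refl))))

    at-nothing : ∀ χ k → [ outside? (lookup χ j) ] * w χ k
      ≈ [ outside? (lookup χ j) ] * weight (extend nothing b D) B χ k
    at-nothing χ k = guarded nothing χ k (is-nothing (lookup χ j))
      where
      is-nothing : ∀ x → outside? x ≡ true → x ≡ nothing
      is-nothing nothing _ = ≡.refl

    at-just : ∀ s χ k → [ sees (just s) (lookup χ j) ] * w χ k
      ≈ [ sees (just s) (lookup χ j) ] * weight (extend (just s) b D) B χ k
    at-just s χ k = guarded (just s) χ k (sees-just s (lookup χ j))

  -- `outside?` and `sees nothing` are complementary.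
  G-outside : ∀ {n} r (j : Fin n) (w : Vec Label n → ℕ → Carrier) →
    G r n (λ χ k → [ outside? (lookup χ j) ] * w χ k) + G r n (λ χ k → [ sees nothing (lookup χ j) ] * w χ k)
      ≈ G r n w
  G-outside {n} r j w = trans (sym (G-+ r n _ _)) (G-cong r n (λ χ k → either (lookup χ j)))
    where
    either : ∀ x {y} → [ outside? x ] * y + [ sees nothing x ] * y ≈ y
    either nothing  = trans (+-cong (*-identityˡ _) (zeroˡ _)) (+-identityʳ _)
    either (just _) = trans (+-cong (zeroˡ _) (*-identityˡ _)) (+-identityˡ _)

  -- The induction needs all `r`, `D` and `B` at once: removing the first element may open a part,
  -- extends `D`, and leads to matrices `addColumn j b B′`. These can have nonzero entries at (j,
  -- j), so the diagonal of `B` is arbitrary and is added to `d`.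
  G-weight : ∀ n r (d : Fin n → Carrier) (D : Fin n → Label → Carrier) (B : Matrix n) →
    Balanced r d D → G r n (weight D B) ≈ κ r * Det (addDiagonal d B)
  G-weight zero    r d D B bal = *-congˡ (reflexive (≡.sym (Det-zero _)))
  G-weight (suc n) r d D B bal = begin
    G r n (λ χ → weight D B (nothing ∷ χ))
      + (∑< r (λ s → G r n (λ χ → weight D B (just s ∷ χ))) + G (suc r) n (λ χ → weight D B (just r ∷ χ)))
      ≈⟨ +-cong (trans (term r nothing) (trans (*-identityˡ _) (+-congʳ (*-congˡ (IH₀ Bal₀)))))
           (+-cong (∑<-cong r (λ s s<r → trans (term r (just s)) (*-congˡ (+-congʳ (*-congˡ (IH₀ (Bals s<r)))))))
             (trans (term (suc r) (just r)) (*-congˡ (+-congʳ (*-congˡ (IH₁ Balr)))))) ⟩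
    (X nothing * z + ∑ (λ j → a j * T₀ j))
      + (∑< r (λ s → - 1# * (X (just s) * z + ∑ (λ j → a j * Tₛ s j)))
        + - 1# * (X (just r) * z₁ + ∑ (λ j → a j * T₁ j)))
      ≈⟨ +-congˡ (+-congʳ (trans (∑<-*ˡ r _ _) (*-congˡ (trans (∑<-+ r _ _) (+-cong (∑<-*ʳ r _ z)
           (trans (∑<-∑ r _) (∑-cong (λ j → ∑<-*ˡ r (a j) _)))))))) ⟩
    (X nothing * z + ∑ (λ j → a j * T₀ j))
      + (- 1# * (∑< r (λ s → X (just s)) * z + ∑ (λ j → a j * ∑< r (λ s → Tₛ s j)))
        + - 1# * (X (just r) * z₁ + ∑ (λ j → a j * T₁ j)))
      ≈⟨ solve 7 (λ p q E u v x y → (p :+ q) :+ (E :* (u :+ v) :+ E :* (x :+ y))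
           := (p :+ (E :* u :+ E :* x)) :+ (q :+ E :* (v :+ y))) refl _ _ (- 1#) _ _ _ _ ⟩
    (X nothing * z + (- 1# * (∑< r (λ s → X (just s)) * z) + - 1# * (X (just r) * z₁)))
      + (∑ (λ j → a j * T₀ j) + - 1# * (∑ (λ j → a j * ∑< r (λ s → Tₛ s j)) + ∑ (λ j → a j * T₁ j)))
      ≈⟨ +-cong constant (trans collect (∑-cong (λ j → *-congˡ (coefficient j)))) ⟩
    (B zero zero + d zero) * z + ∑ (λ j → a j * (κ r * (Δ + - Δ⁺ j)))
      ≈⟨ +-cong (*-leftComm _ _ _) (trans (∑-cong (λ j → *-leftComm _ _ _)) (∑-*ˡ _ _)) ⟩
    κ r * ((B zero zero + d zero) * Δ) + κ r * ∑ (λ j → a j * (Δ + - Δ⁺ j))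
      ≈⟨ distribˡ _ _ _ ⟨
    κ r * ((B zero zero + d zero) * Δ + ∑ (λ j → a j * (Δ + - Δ⁺ j)))
      ≈⟨ *-congˡ determinant ⟨
    κ r * Det (addDiagonal d B) ∎
    where
    B′ = minor zero zero B
    a b d′ : Fin n → Carrier
    a j = B zero (suc j)
    b i = B (suc i) zero
    d′ i = d (suc i)

    D′ : Fin n → Label → Carrier
    D′ i = D (suc i)

    W : Label → Vec Label n → ℕ → Carrier
    W l = weight (extend l b D′) B′

    Δ = Det (addDiagonal d′ B′)
    z = κ r * Δ
    z₁ = κ (suc r) * Δ

    Δ⁺ : Fin n → Carrier
    Δ⁺ j = Det (addDiagonal d′ (addColumn j b B′))

    X : Label → Carrier
    X l = D zero l + [ sees l l ] * B zero zero

    H : ℕ → Label → Fin n → Carrier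
    H t l j = G t n (λ χ k → [ sees l (lookup χ j) ] * W l χ k)

    T₀ T₁ : Fin n → Carrier
    T₀ j = H r nothing j
    T₁ j = H (suc r) (just r) j

    Tₛ : ℕ → Fin n → Carrier
    Tₛ s j = H r (just s) j

    bal′ : Balanced r d′ D′
    bal′ = Balanced-tail bal

    Bal₀ : Balanced r d′ (extend nothing b D′)
    Bal₀ = Balanced-nothing bal′

    Bals : ∀ {s} → s < r → Balanced r d′ (extend (just s) b D′)
    Bals s<r = Balanced-just s<r bal′

    Balr : Balanced (suc r) d′ (extend (just r) b D′)
    Balr = Balanced-just ℕ.≤-refl (Balanced-suc bal′)

    IH₀ : ∀ {l} → Balanced r d′ (extend l b D′) → G r n (W l) ≈ z
    IH₀ = G-weight n r d′ _ B′

    IH₁ : Balanced (suc r) d′ (extend (just r) b D′) → G (suc r) n (W (just r)) ≈ z₁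
    IH₁ = G-weight n (suc r) d′ _ B′

    term : ∀ t l → G t n (λ χ → weight D B (l ∷ χ)) ≈ σ l * (X l * G t n (W l) + ∑ (λ j → a j * H t l j))
    term t l = begin
      _ ≈⟨ G-cong t n (λ χ k → weight-∷ D B l χ k) ⟩
      _ ≈⟨ G-*ˡ t n (σ l) _ ⟩
      _ ≈⟨ *-congˡ (trans (G-+ t n _ _) (+-cong (G-*ˡ t n (X l) _)
             (trans (G-∑ t n _) (∑-cong (λ j → G-*ˡ t n (a j) _))))) ⟩
      _ ∎

    E = - 1#

    -- Each of the `r` existing parts yields -b₀ z, and the new part yields (1 + N) b₀ z, since
    -- `κ (suc r)` is -(1 + N) times `κ r`; one b₀ z is left.
    constant : X nothing * z + (E * (∑< r (λ s → X (just s)) * z) + E * (X (just r) * z₁))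
      ≈ (B zero zero + d zero) * z
    constant = begin
      X nothing * z + (E * (∑< r (λ s → X (just s)) * z) + E * (X (just r) * z₁))
        ≈⟨ +-cong (*-congʳ X₀) (+-cong (*-congˡ (*-congʳ Xs)) (*-congˡ (*-cong Xr (trans (*-congʳ (κ-suc r)) (*-assoc _ _ _))))) ⟩
      (d zero + S) * z + (E * ((S + N * b₀) * z) + E * (b₀ * (E * (((1# + N) * κ r) * Δ))))
        ≈⟨ +-congˡ (+-congˡ (trans (*-congˡ (*-leftComm _ _ _)) (trans (sym (*-assoc _ _ _))
             (trans (*-congʳ (trans (-1*x≈-x _) (-‿involutive 1#))) (*-identityˡ _))))) ⟩
      (d zero + S) * z + (E * ((S + N * b₀) * z) + b₀ * (((1# + N) * κ r) * Δ))
        ≈⟨ +-congˡ (+-congˡ (*-congˡ (trans (*-assoc _ _ _) (trans (distribʳ _ _ _) (+-congʳ (*-identityˡ _)))))) ⟩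
      (d zero + S) * z + (E * ((S + N * b₀) * z) + b₀ * (z + N * z))
        ≈⟨ solve 6 (λ d S z E N b → (d :+ S) :* z :+ (E :* ((S :+ N :* b) :* z) :+ b :* (z :+ N :* z))
             := (b :+ d) :* z :+ (E :* ((S :+ N :* b) :* z) :+ (S :+ N :* b) :* z)) refl (d zero) S z E N b₀ ⟩
      (b₀ + d zero) * z + (E * ((S + N * b₀) * z) + (S + N * b₀) * z)
        ≈⟨ +-congˡ (trans (+-congʳ (-1*x≈-x _)) (-‿inverseˡ _)) ⟩
      (b₀ + d zero) * z + 0#
        ≈⟨ +-identityʳ _ ⟩
      (b₀ + d zero) * z ∎
      where
      b₀ = B zero zero
      N  = natCast R r
      S  = ∑< r (λ s → D zero (just s))

      X₀ : X nothing ≈ d zero + S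
      X₀ = trans (+-congˡ (zeroˡ _)) (trans (+-identityʳ _) (out-sum bal zero))

      Xs : ∑< r (λ s → X (just s)) ≈ S + N * b₀
      Xs = trans (∑<-cong r (λ s _ → +-congˡ ([true]* b₀ (≡ᵇ-refl s))))
        (trans (∑<-+ r _ _) (+-congˡ (∑<-const r b₀)))

      Xr : X (just r) ≈ b₀
      Xr = trans (+-cong (vanish bal zero r ℕ.≤-refl) ([true]* b₀ (≡ᵇ-refl r))) (+-identityˡ _)

    collect : ∑ (λ j → a j * T₀ j) + E * (∑ (λ j → a j * ∑< r (λ s → Tₛ s j)) + ∑ (λ j → a j * T₁ j))
      ≈ ∑ (λ j → a j * (T₀ j + E * (∑< r (λ s → Tₛ s j) + T₁ j)))
    collect = begin
      _ ≈⟨ +-congˡ (trans (*-congˡ (sym (∑-+ _ _))) (sym (∑-*ˡ _ _))) ⟩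
      _ ≈⟨ ∑-+ _ _ ⟨
      _ ≈⟨ ∑-cong (λ j → solve 5 (λ a t E u v → a :* t :+ E :* (a :* u :+ a :* v)
             := a :* (t :+ E :* (u :+ v))) refl (a j) (T₀ j) E _ (T₁ j)) ⟩
      _ ∎

    coefficient : ∀ j → T₀ j + E * (∑< r (λ s → Tₛ s j) + T₁ j) ≈ κ r * (Δ + - Δ⁺ j)
    coefficient j = begin
      T₀ j + E * Y                       ≈⟨ +-congˡ (-1*x≈-x _) ⟩
      -- `P` consists of the terms in which neither the first element nor `j` is covered. With it,
      -- `T₀ j` becomes the full sum with the first element uncovered, and `Y` the full sum with the
      -- first element merged into `j`.
      T₀ j + - Y                         ≈⟨ x-x+y≈y P _ ⟨
      - P + (P + (T₀ j + - Y))           ≈⟨ +-congˡ (sym (+-assoc _ _ _)) ⟩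
      - P + ((P + T₀ j) + - Y)           ≈⟨ +-leftComm _ _ _ ⟩
      (P + T₀ j) + (- P + - Y)           ≈⟨ +-congˡ (-‿+-comm P Y) ⟩
      (P + T₀ j) + - (P + Y)             ≈⟨ +-cong (G-outside r j (W nothing)) (-‿cong (sym (G-addColumn r d′ D′ B′ b j bal′))) ⟩
      G r n (W nothing) + - G r n (weight D′ (addColumn j b B′))
        ≈⟨ +-cong (IH₀ Bal₀) (-‿cong (G-weight n r d′ D′ (addColumn j b B′) bal′)) ⟩
      κ r * Δ + - (κ r * Δ⁺ j)           ≈⟨ +-congˡ (-‿distribʳ-* _ _) ⟩
      κ r * Δ + κ r * - Δ⁺ j             ≈⟨ distribˡ _ _ _ ⟨
      κ r * (Δ + - Δ⁺ j)                 ∎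
      where
      P = G r n (λ χ k → [ outside? (lookup χ j) ] * W nothing χ k)
      Y = ∑< r (λ s → Tₛ s j) + T₁ j

    determinant : Det (addDiagonal d B) ≈ (B zero zero + d zero) * Δ + ∑ (λ j → a j * (Δ + - Δ⁺ j))
    determinant = trans (Det-contract (addDiagonal d B)) (+-cong
      (*-congʳ (+-congˡ (*-identityˡ _)))
      -- Adding the diagonal commutes with adding a column.
      (∑-cong (λ j → *-cong (off (a j)) (+-congˡ (-‿cong (Det-cong (λ i k →
        trans (+-congˡ (*-congˡ (off (b i)))) (trans (+-assoc _ _ _) (trans (+-congˡ (+-comm _ _)) (sym (+-assoc _ _ _)))))))))))
      where
      off : ∀ x {y} → x + 0# * y ≈ x
      off x = trans (+-congˡ (zeroˡ _)) (+-identityʳ x)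

-- From label vectors to lists of parts.

extendOut : ∀ {n} → List (Subset n) → List (Subset (suc n))
extendOut = List.map (outside ∷_)

-- Junk value: an index beyond the end of the list is ignored.
extendAt : ∀ {n} → ℕ → List (Subset n) → List (Subset (suc n))
extendAt s       []      = []
extendAt zero    (S ∷ P) = (inside ∷ S) ∷ extendOut P
extendAt (suc s) (S ∷ P) = (outside ∷ S) ∷ extendAt s P

extendParts : ∀ {n} → Label → List (Subset n) → List (Subset (suc n))
extendParts nothing  = extendOut
extendParts (just s) = extendAt s

-- The parts described by a label vector with k parts; unused parts are empty.
decode : ∀ {n} → Vec Label n → ℕ → List (Subset n)
decode []      k = List.replicate k []
decode (l ∷ χ) k = extendParts l (decode χ k)

nonempty-extendOut : ∀ {n} (P : List (Subset n)) → allL nonemptyᵇ (extendOut P) ≡ allL nonemptyᵇ P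
nonempty-extendOut []      = ≡.refl
nonempty-extendOut (S ∷ P) = ≡.cong (nonemptyᵇ S ∧_) (nonempty-extendOut P)

disjoint-extendOut : ∀ {n} b (S : Subset n) P → allL (disjointᵇ (b ∷ S)) (extendOut P) ≡ allL (disjointᵇ S) P
disjoint-extendOut b     S []      = ≡.refl
disjoint-extendOut true  S (T ∷ P) = ≡.cong (disjointᵇ S T ∧_) (disjoint-extendOut true S P)
disjoint-extendOut false S (T ∷ P) = ≡.cong (disjointᵇ S T ∧_) (disjoint-extendOut false S P)

disjoint-extendAt : ∀ {n} s (S : Subset n) P → allL (disjointᵇ (outside ∷ S)) (extendAt s P) ≡ allL (disjointᵇ S) P
disjoint-extendAt zero    S []      = ≡.refl
disjoint-extendAt (suc s) S []      = ≡.refl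
disjoint-extendAt zero    S (T ∷ P) = ≡.cong (disjointᵇ S T ∧_) (disjoint-extendOut false S P)
disjoint-extendAt (suc s) S (T ∷ P) = ≡.cong (disjointᵇ S T ∧_) (disjoint-extendAt s S P)

-- The new element lies in both `inside ∷ S` and the part at position `s`.
clash-extendAt : ∀ {n} s (S : Subset n) P → s < length P → allL (disjointᵇ (inside ∷ S)) (extendAt s P) ≡ false
clash-extendAt zero    S (T ∷ P) _         = ≡.refl
clash-extendAt (suc s) S (T ∷ P) (s≤s s<k) =
  ≡.trans (≡.cong (disjointᵇ S T ∧_) (clash-extendAt s S P s<k)) (∧-zeroʳ _)

pairwiseDisjoint-extendOut : ∀ {n} (P : List (Subset n)) → pairwiseDisjointᵇ (extendOut P) ≡ pairwiseDisjointᵇ P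
pairwiseDisjoint-extendOut []      = ≡.refl
pairwiseDisjoint-extendOut (S ∷ P) = ≡.cong₂ _∧_ (disjoint-extendOut false S P) (pairwiseDisjoint-extendOut P)

pairwiseDisjoint-extendAt : ∀ {n} s (P : List (Subset n)) → pairwiseDisjointᵇ (extendAt s P) ≡ pairwiseDisjointᵇ P
pairwiseDisjoint-extendAt zero    []      = ≡.refl
pairwiseDisjoint-extendAt (suc s) []      = ≡.refl
pairwiseDisjoint-extendAt zero    (S ∷ P) = ≡.cong₂ _∧_ (disjoint-extendOut true S P) (pairwiseDisjoint-extendOut P)
pairwiseDisjoint-extendAt (suc s) (S ∷ P) = ≡.cong₂ _∧_ (disjoint-extendAt s S P) (pairwiseDisjoint-extendAt s P)

pairwiseDisjoint-extendParts : ∀ {n} l (P : List (Subset n)) → pairwiseDisjointᵇ (extendParts l P) ≡ pairwiseDisjointᵇ P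
pairwiseDisjoint-extendParts nothing  = pairwiseDisjoint-extendOut
pairwiseDisjoint-extendParts (just s) = pairwiseDisjoint-extendAt s

pairwiseDisjoint-decode : ∀ {n} (χ : Vec Label n) k → pairwiseDisjointᵇ (decode χ k) ≡ true
pairwiseDisjoint-decode []      k = empties k
  where
  all-disjoint : ∀ k → allL (disjointᵇ []) (List.replicate k []) ≡ true
  all-disjoint zero    = ≡.refl
  all-disjoint (suc k) = all-disjoint k

  empties : ∀ k → pairwiseDisjointᵇ (List.replicate k []) ≡ true
  empties zero    = ≡.refl
  empties (suc k) = ≡.cong₂ _∧_ (all-disjoint k) (empties k)
pairwiseDisjoint-decode (l ∷ χ) k =
  ≡.trans (pairwiseDisjoint-extendParts l (decode χ k)) (pairwiseDisjoint-decode χ k)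

length-extendParts : ∀ {n} l (P : List (Subset n)) → length (extendParts l P) ≡ length P
length-extendParts nothing        []      = ≡.refl
length-extendParts (just zero)    []      = ≡.refl
length-extendParts (just (suc s)) []      = ≡.refl
length-extendParts nothing        (S ∷ P) = ≡.cong suc (length-extendParts nothing P)
length-extendParts (just zero)    (S ∷ P) = ≡.cong suc (length-extendParts nothing P)
length-extendParts (just (suc s)) (S ∷ P) = ≡.cong suc (length-extendParts (just s) P)

length-decode : ∀ {n} (χ : Vec Label n) k → length (decode χ k) ≡ k
length-decode []      zero    = ≡.refl
length-decode []      (suc k) = ≡.cong suc (length-decode [] k)
length-decode (l ∷ χ) k       = ≡.trans (length-extendParts l (decode χ k)) (length-decode χ k)

member : ∀ {n} → ℕ → List (Subset n) → Fin n → Bool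
member s       []      j = false
member zero    (S ∷ P) j = j ∈ᵇ S
member (suc s) (S ∷ P) j = member s P j

member-extend-suc : ∀ {n} s l (P : List (Subset n)) j → member s (extendParts l P) (suc j) ≡ member s P j
member-extend-suc s       nothing        []      j = ≡.refl
member-extend-suc s       (just zero)    []      j = ≡.refl
member-extend-suc s       (just (suc t)) []      j = ≡.refl
member-extend-suc zero    nothing        (S ∷ P) j = ≡.refl
member-extend-suc zero    (just zero)    (S ∷ P) j = ≡.refl
member-extend-suc zero    (just (suc t)) (S ∷ P) j = ≡.refl
member-extend-suc (suc s) nothing        (S ∷ P) j = member-extend-suc s nothing P j
member-extend-suc (suc s) (just zero)    (S ∷ P) j = member-extend-suc s nothing P j
member-extend-suc (suc s) (just (suc t)) (S ∷ P) j = member-extend-suc s (just t) P j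

member-extendOut-zero : ∀ {n} s (P : List (Subset n)) → member s (extendOut P) zero ≡ false
member-extendOut-zero s       []      = ≡.refl
member-extendOut-zero zero    (S ∷ P) = ≡.refl
member-extendOut-zero (suc s) (S ∷ P) = member-extendOut-zero s P

member-extendAt-zero : ∀ {n} s t (P : List (Subset n)) → t < length P → member s (extendAt t P) zero ≡ (s ≡ᵇ t)
member-extendAt-zero zero    zero    (S ∷ P) _         = ≡.refl
member-extendAt-zero (suc s) zero    (S ∷ P) _         = member-extendOut-zero s P
member-extendAt-zero zero    (suc t) (S ∷ P) _         = ≡.refl
member-extendAt-zero (suc s) (suc t) (S ∷ P) (s≤s t<k) = member-extendAt-zero s t P t<k

∼-extend-suc : ∀ {n} l (P : List (Subset n)) i j → (suc i ∼[ extendParts l P ] suc j) ≡ (i ∼[ P ] j)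
∼-extend-suc nothing        []      i j = ≡.refl
∼-extend-suc (just zero)    []      i j = ≡.refl
∼-extend-suc (just (suc s)) []      i j = ≡.refl
∼-extend-suc nothing        (S ∷ P) i j = ≡.cong (_ ∨_) (∼-extend-suc nothing P i j)
∼-extend-suc (just zero)    (S ∷ P) i j = ≡.cong (_ ∨_) (∼-extend-suc nothing P i j)
∼-extend-suc (just (suc s)) (S ∷ P) i j = ≡.cong (_ ∨_) (∼-extend-suc (just s) P i j)

∼-extendOut-zeroˡ : ∀ {n} (P : List (Subset n)) j → (zero ∼[ extendOut P ] j) ≡ false
∼-extendOut-zeroˡ []      j = ≡.refl
∼-extendOut-zeroˡ (S ∷ P) j = ∼-extendOut-zeroˡ P j

∼-extendAt-zeroˡ : ∀ {n} s (P : List (Subset n)) j → (zero ∼[ extendAt s P ] suc j) ≡ member s P j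
∼-extendAt-zeroˡ zero    []      j = ≡.refl
∼-extendAt-zeroˡ (suc s) []      j = ≡.refl
∼-extendAt-zeroˡ zero    (S ∷ P) j = ≡.trans (≡.cong (_ ∨_) (∼-extendOut-zeroˡ P (suc j))) (∨-identityʳ _)
∼-extendAt-zeroˡ (suc s) (S ∷ P) j = ∼-extendAt-zeroˡ s P j

∼-extendAt-zero : ∀ {n} s (P : List (Subset n)) → s < length P → (zero ∼[ extendAt s P ] zero) ≡ true
∼-extendAt-zero zero    (S ∷ P) _         = ≡.refl
∼-extendAt-zero (suc s) (S ∷ P) (s≤s s<k) = ∼-extendAt-zero s P s<k

∧-comm-∨ : ∀ a b {c d} → c ≡ d → (a ∧ b) ∨ c ≡ (b ∧ a) ∨ d
∧-comm-∨ false false eq = eq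
∧-comm-∨ false true  eq = eq
∧-comm-∨ true  false eq = eq
∧-comm-∨ true  true  eq = ≡.refl

∼-sym : ∀ {n} (P : List (Subset n)) i j → (i ∼[ P ] j) ≡ (j ∼[ P ] i)
∼-sym []      i j = ≡.refl
∼-sym (S ∷ P) i j = ∧-comm-∨ (i ∈ᵇ S) (j ∈ᵇ S) (∼-sym P i j)

-- The relation `∼[ P ]` on labels. Unlike `sees`, it relates an uncovered element to nothing.
same : Label → Label → Bool
same nothing  _ = false
same (just s) y = sees (just s) y

≡ᵇ-sym : ∀ a b → (a ≡ᵇ b) ≡ (b ≡ᵇ a)
≡ᵇ-sym zero    zero    = ≡.refl
≡ᵇ-sym zero    (suc b) = ≡.refl
≡ᵇ-sym (suc a) zero    = ≡.refl
≡ᵇ-sym (suc a) (suc b) = ≡ᵇ-sym a b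

same-sym : ∀ x y → same x y ≡ same y x
same-sym nothing  nothing  = ≡.refl
same-sym nothing  (just _) = ≡.refl
same-sym (just _) nothing  = ≡.refl
same-sym (just a) (just b) = ≡ᵇ-sym a b

<length-decode : ∀ {n s k} (χ : Vec Label n) → s < k → s < length (decode χ k)
<length-decode {k = k} χ s<k = ≡.subst (_ <_) (≡.sym (length-decode χ k)) s<k

member-decode : ∀ {n k} s {χ : Vec Label n} → Bounded k χ → ∀ j →
  member s (decode χ k) j ≡ sees (just s) (lookup χ j)
member-decode s (out {χ = χ} b)          zero    = member-extendOut-zero s (decode χ _)
member-decode s (into {χ = χ} t<k b)     zero    = member-extendAt-zero s _ (decode χ _) (<length-decode χ t<k)
member-decode s (out {χ = χ} b)          (suc j) =
  ≡.trans (member-extend-suc s nothing (decode χ _) j) (member-decode s b j)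
member-decode s (into {s = t} {χ} t<k b) (suc j) =
  ≡.trans (member-extend-suc s (just t) (decode χ _) j) (member-decode s b j)

∼-decode : ∀ {n k} {χ : Vec Label n} → Bounded k χ → ∀ i j →
  (i ∼[ decode χ k ] j) ≡ same (lookup χ i) (lookup χ j)
∼-decode (out {χ = χ} b) zero j = ∼-extendOut-zeroˡ (decode χ _) j
∼-decode (into {s = s} {χ} s<k b) zero zero =
  ≡.trans (∼-extendAt-zero s (decode χ _) (<length-decode χ s<k)) (≡.sym (≡ᵇ-refl s))
∼-decode (into {s = s} {χ} s<k b) zero (suc j) =
  ≡.trans (∼-extendAt-zeroˡ s (decode χ _) j) (member-decode s b j)
∼-decode {k = k} (out {χ = χ} b) (suc i) zero = ≡.trans (∼-sym (decode (nothing ∷ χ) k) (suc i) zero)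
  (≡.trans (∼-extendOut-zeroˡ (decode χ k) (suc i)) (same-sym nothing (lookup χ i)))
∼-decode {k = k} (into {s = s} {χ} s<k b) (suc i) zero = ≡.trans (∼-sym (decode (just s ∷ χ) k) (suc i) zero)
  (≡.trans (∼-extendAt-zeroˡ s (decode χ k) i) (≡.trans (member-decode s b i) (same-sym (just s) (lookup χ i))))
∼-decode (out {χ = χ} b) (suc i) (suc j) =
  ≡.trans (∼-extend-suc nothing (decode χ _) i j) (∼-decode b i j)
∼-decode (into {s = s} {χ} s<k b) (suc i) (suc j) =
  ≡.trans (∼-extend-suc (just s) (decode χ _) i j) (∼-decode b i j)

-- The summand of a decoded list of parts.

module Parts {c ℓ} (R : CommutativeRing c ℓ) where
  open Summation R
  open Growth R
  open Determinant R
  open Expansion R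

  sgn-extendOut : ∀ {n} (P : List (Subset n)) → sgn R (extendOut P) ≡ sgn R P
  sgn-extendOut []      = ≡.refl
  sgn-extendOut (S ∷ P) = ≡.cong (neg1^ R (suc (card S)) *_) (sgn-extendOut P)

  sgn-extendAt : ∀ {n} s (P : List (Subset n)) → s < length P → sgn R (extendAt s P) ≈ - 1# * sgn R P
  sgn-extendAt zero (S ∷ P) _ = begin
    - neg1^ R (suc (card S)) * sgn R (extendOut P)
      ≈⟨ *-cong (sym (-1*x≈-x _)) (reflexive (sgn-extendOut P)) ⟩
    (- 1# * neg1^ R (suc (card S))) * sgn R P
      ≈⟨ *-assoc _ _ _ ⟩
    - 1# * (neg1^ R (suc (card S)) * sgn R P) ∎
  sgn-extendAt (suc s) (S ∷ P) (s≤s s<k) = trans (*-congˡ (sgn-extendAt s P s<k)) (*-leftComm _ _ _)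

  -- Each of the `k` initially empty parts has sign -1, and every element placed in a part reverses
  -- the sign of that part.
  sgn-decode : ∀ {n k} {χ : Vec Label n} → Bounded k χ →
    sgn R (decode χ k) ≈ neg1^ R k * ∏ (λ i → σ (lookup χ i))
  sgn-decode {k = zero}  [] = sym (*-identityˡ 1#)
  sgn-decode {k = suc k} [] = begin
    - 1# * sgn R (decode [] k)   ≈⟨ *-congˡ (sgn-decode {k = k} []) ⟩
    - 1# * (neg1^ R k * 1#)      ≈⟨ *-assoc _ _ _ ⟨
    (- 1# * neg1^ R k) * 1#      ≈⟨ *-congʳ (-1*x≈-x _) ⟩
    - neg1^ R k * 1#             ∎
  sgn-decode (out {χ = χ} b) = trans (reflexive (sgn-extendOut (decode χ _)))
    (trans (sgn-decode b) (*-congˡ (sym (*-identityˡ _))))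
  sgn-decode (into {χ = χ} s<k b) = trans (sgn-extendAt _ (decode χ _) (<length-decode χ s<k))
    (trans (*-congˡ (sgn-decode b)) (*-leftComm _ _ _))

  offDiagonal : ∀ {n} → Matrix n → Matrix n
  offDiagonal A i j = if does (i ≟ j) then 0# else A i j

  diagonal : ∀ {n} → Matrix n → Fin n → Label → Carrier
  diagonal A i nothing  = A i i
  diagonal A i (just _) = 0#

  -- The entry `A i i` occurs in the factor of `i` exactly when `i` is uncovered, and then as the
  -- separate term. It therefore goes into `D`, and the matrix is left with a zero diagonal.
  factor-decode : ∀ {n k} (A : Matrix n) {χ : Vec Label n} → Bounded k χ → ∀ i →
    factor R n A (decode χ k) i ≈ linear (diagonal A) (offDiagonal A) χ i
  factor-decode {n} {k} A {χ} b i = at (lookup χ i) ≡.refl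
    where
    P = decode χ k

    inner : ∀ c e {a} → (if c ∧ not e then a else 0#) ≈ [ c ] * (if e then 0# else a)
    inner false e     = sym (zeroˡ _)
    inner true  false = sym (*-identityˡ _)
    inner true  true  = sym (zeroʳ _)

    -- An uncovered `i` is not among the covered `j`, so the zero at `j` = `i` changes nothing.
    outer : ∀ c e {a} → (e ≡ true → c ≡ false) → (if c then a else 0#) ≈ [ c ] * (if e then 0# else a)
    outer false e     h = sym (zeroˡ _)
    outer true  false h = sym (*-identityˡ _)
    outer true  true  h with () ← h ≡.refl

    same-refl : ∀ x → same x x ≡ sees nothing x
    same-refl nothing  = ≡.refl
    same-refl (just s) = ≡ᵇ-refl s

    factor-inside : (i ∼[ P ] i) ≡ true →
      factor R n A P i ≡ ∑ (λ j → if (i ∼[ P ] j) ∧ not (does (i ≟ j)) then A i j else 0#)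
    factor-inside eq rewrite eq = ≡.sym (∑-def _)

    factor-outside : (i ∼[ P ] i) ≡ false →
      factor R n A P i ≡ A i i + ∑ (λ j → if j ∼[ P ] j then A i j else 0#)
    factor-outside eq rewrite eq = ≡.cong (A i i +_) (≡.sym (∑-def _))

    at : ∀ x → lookup χ i ≡ x →
      factor R n A P i ≈ diagonal A i x + ∑ (λ j → [ sees x (lookup χ j) ] * offDiagonal A i j)
    at nothing eq = trans
      (reflexive (factor-outside (≡.trans (∼-decode b i i) (≡.cong (λ x → same x x) eq))))
      (+-congˡ (∑-cong (λ j → trans
        (reflexive (≡.cong (λ c → if c then A i j else 0#) (≡.trans (∼-decode b j j) (same-refl (lookup χ j)))))
        (outer _ (does (i ≟ j)) (hidden j)))))
      where
      hidden : ∀ j → does (i ≟ j) ≡ true → sees nothing (lookup χ j) ≡ false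
      hidden j _ with i ≟ j
      ... | yes ≡.refl = ≡.cong (sees nothing) eq
    at (just s) eq = trans
      (reflexive (factor-inside (≡.trans (∼-decode b i i) (≡.trans (≡.cong (λ x → same x x) eq) (≡ᵇ-refl s)))))
      (trans (∑-cong (λ j → trans
        (reflexive (≡.cong (λ c → if c ∧ not (does (i ≟ j)) then A i j else 0#)
          (≡.trans (∼-decode b i j) (≡.cong (λ x → same x (lookup χ j)) eq))))
        (inner _ (does (i ≟ j)))))
      (sym (+-identityˡ _)))

  summand : ∀ {n} → Matrix n → List (Subset n) → Carrier
  summand {n} A P = sgn R P * (natCast R (numParts P !) * ΠFin R n (factor R n A P))

  summand-decode : ∀ {n k} (A : Matrix n) {χ : Vec Label n} → Bounded k χ →
    summand A (decode χ k) ≈ weight (diagonal A) (offDiagonal A) χ k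
  summand-decode {n} {k} A {χ} b = begin
    sgn R (decode χ k) * (natCast R (length (decode χ k) !) * ∏ (factor R n A (decode χ k)))
      ≈⟨ *-cong (sgn-decode b) (*-cong (reflexive (≡.cong (λ m → natCast R (m !)) (length-decode χ k)))
           (∏-cong (factor-decode A b))) ⟩
    (neg1^ R k * Σσ) * (natCast R (k !) * Λ)
      ≈⟨ *-interchange _ _ _ _ ⟩
    κ k * (Σσ * Λ)
      ≈⟨ *-congˡ (sym (∏-* (λ i → σ (lookup χ i)) _)) ⟩
    weight (diagonal A) (offDiagonal A) χ k ∎
    where
    Σσ = ∏ (λ i → σ (lookup χ i))
    Λ  = ∏ (linear (diagonal A) (offDiagonal A) χ)

  -- Sums over partial partitions as sums over label vectors.

  ∑L : ∀ {a} {X : Set a} → List X → (X → Carrier) → Carrier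
  ∑L = ΣList R

  ∑L-cong : ∀ {a} {X : Set a} (xs : List X) {f g} → (∀ x → f x ≈ g x) → ∑L xs f ≈ ∑L xs g
  ∑L-cong []       h = refl
  ∑L-cong (x ∷ xs) h = +-cong (h x) (∑L-cong xs h)

  ∑L-0 : ∀ {a} {X : Set a} (xs : List X) {f} → (∀ x → f x ≈ 0#) → ∑L xs f ≈ 0#
  ∑L-0 []       h = refl
  ∑L-0 (x ∷ xs) h = trans (+-cong (h x) (∑L-0 xs h)) (+-identityˡ 0#)

  ∑L-+ : ∀ {a} {X : Set a} (xs : List X) f g → ∑L xs (λ x → f x + g x) ≈ ∑L xs f + ∑L xs g
  ∑L-+ []       f g = sym (+-identityˡ 0#)
  ∑L-+ (x ∷ xs) f g = trans (+-congˡ (∑L-+ xs f g)) (+-interchange _ _ _ _)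

  ∑L-∑< : ∀ {a} {X : Set a} (xs : List X) r (f : ℕ → X → Carrier) →
    ∑L xs (λ x → ∑< r (λ s → f s x)) ≈ ∑< r (λ s → ∑L xs (f s))
  ∑L-∑< xs zero    f = ∑L-0 xs (λ _ → refl)
  ∑L-∑< xs (suc r) f = trans (∑L-+ xs _ _) (+-congʳ (∑L-∑< xs r f))

  ∑L-++ : ∀ {a} {X : Set a} (xs ys : List X) f → ∑L (xs ++ ys) f ≈ ∑L xs f + ∑L ys f
  ∑L-++ []       ys f = sym (+-identityˡ _)
  ∑L-++ (x ∷ xs) ys f = trans (+-congˡ (∑L-++ xs ys f)) (sym (+-assoc _ _ _))

  ∑L-map : ∀ {a b} {X : Set a} {Y : Set b} (g : X → Y) xs f → ∑L (List.map g xs) f ≈ ∑L xs (λ x → f (g x))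
  ∑L-map g []       f = refl
  ∑L-map g (x ∷ xs) f = +-congˡ (∑L-map g xs f)

  ∑L-filter : ∀ {a} {X : Set a} (q : X → Bool) xs f → ∑L (filterᵇ q xs) f ≈ ∑L xs (λ x → [ q x ] * f x)
  ∑L-filter q []       f = refl
  ∑L-filter q (x ∷ xs) f with q x
  ... | true  = +-cong (sym (*-identityˡ _)) (∑L-filter q xs f)
  ... | false = trans (∑L-filter q xs f) (trans (sym (+-identityˡ _)) (+-congʳ (sym (zeroˡ _))))

  ∑L-sublists-∷ : ∀ {a} {X : Set a} (x : X) xs f →
    ∑L (sublists (x ∷ xs)) f ≈ ∑L (sublists xs) (λ P → f (x ∷ P)) + ∑L (sublists xs) f
  ∑L-sublists-∷ x xs f = trans (∑L-++ (List.map (x ∷_) (sublists xs)) _ f) (+-congʳ (∑L-map (x ∷_) (sublists xs) f))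

  ∑L-sublists-++ : ∀ {a} {X : Set a} (xs ys : List X) f →
    ∑L (sublists (xs ++ ys)) f ≈ ∑L (sublists xs) (λ Q → ∑L (sublists ys) (λ P → f (Q ++ P)))
  ∑L-sublists-++ []       ys f = sym (+-identityʳ _)
  ∑L-sublists-++ (x ∷ xs) ys f = begin
    ∑L (sublists (x ∷ xs ++ ys)) f
      ≈⟨ ∑L-sublists-∷ x (xs ++ ys) f ⟩
    ∑L (sublists (xs ++ ys)) (λ P → f (x ∷ P)) + ∑L (sublists (xs ++ ys)) f
      ≈⟨ +-cong (∑L-sublists-++ xs ys _) (∑L-sublists-++ xs ys f) ⟩
    _ ≈⟨ ∑L-sublists-∷ x xs _ ⟨
    ∑L (sublists (x ∷ xs)) (λ Q → ∑L (sublists ys) (λ P → f (Q ++ P))) ∎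

  ∑L-sublists-map : ∀ {a b} {X : Set a} {Y : Set b} (g : X → Y) xs f →
    ∑L (sublists (List.map g xs)) f ≈ ∑L (sublists xs) (λ P → f (List.map g P))
  ∑L-sublists-map g []       f = refl
  ∑L-sublists-map g (x ∷ xs) f = begin
    _ ≈⟨ ∑L-sublists-∷ (g x) (List.map g xs) f ⟩
    _ ≈⟨ +-cong (∑L-sublists-map g xs _) (∑L-sublists-map g xs f) ⟩
    _ ≈⟨ ∑L-sublists-∷ x xs _ ⟨
    _ ∎

  ∑L-sublists-empty : ∀ {a} {X : Set a} (xs : List X) f → (∀ x P → f (x ∷ P) ≈ 0#) → ∑L (sublists xs) f ≈ f []
  ∑L-sublists-empty []       f h = +-identityʳ _
  ∑L-sublists-empty (x ∷ xs) f h = begin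
    _ ≈⟨ ∑L-sublists-∷ x xs f ⟩
    _ ≈⟨ +-cong (∑L-0 (sublists xs) (h x)) (∑L-sublists-empty xs f h) ⟩
    0# + f [] ≈⟨ +-identityˡ _ ⟩
    f [] ∎

  ∑L-sublists-singletons : ∀ {a} {X : Set a} (xs : List X) f → (∀ x y P → f (x ∷ y ∷ P) ≈ 0#) →
    ∑L (sublists xs) f ≈ f [] + ∑L xs (λ x → f (x ∷ []))
  ∑L-sublists-singletons []       f h = refl
  ∑L-sublists-singletons (x ∷ xs) f h = begin
    _ ≈⟨ ∑L-sublists-∷ x xs f ⟩
    _ ≈⟨ +-cong (∑L-sublists-empty xs _ (h x)) (∑L-sublists-singletons xs f h) ⟩
    _ ≈⟨ +-leftComm _ _ _ ⟩
    _ ∎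

  -- Sum over r distinguished, possibly empty, parts followed by a list of nonempty parts.
  Z : ∀ n → ℕ → (List (Subset n) → Carrier) → Carrier
  Z n zero    F = ∑L (sublists (allSubsets n)) (λ P → [ allL nonemptyᵇ P ] * F P)
  Z n (suc r) F = ∑L (allSubsets n) (λ S → Z n r (λ P → F (S ∷ P)))

  Z-0 : ∀ n r {F} → (∀ P → r ≤ length P → F P ≈ 0#) → Z n r F ≈ 0#
  Z-0 n zero    h = ∑L-0 (sublists (allSubsets n)) (λ P → trans (*-congˡ (h P z≤n)) (zeroʳ _))
  Z-0 n (suc r) h = ∑L-0 (allSubsets n) (λ S → Z-0 n r (λ P r≤k → h (S ∷ P) (s≤s r≤k)))

  -- The range of summation in `Z` does not enforce disjointness; the summand does, by vanishing
  -- elsewhere.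
  Supported : ∀ {n} → (List (Subset n) → Carrier) → Set ℓ
  Supported F = ∀ P → pairwiseDisjointᵇ P ≡ false → F P ≈ 0#

  Supported-∷ : ∀ {n F} (S : Subset n) → Supported F → Supported (λ P → F (S ∷ P))
  Supported-∷ S sup P eq = sup (S ∷ P) (≡.trans (≡.cong (allL (disjointᵇ S) P ∧_) eq) (∧-zeroʳ _))

  ∑<-shift : ∀ r f → ∑< (suc r) f ≈ f 0 + ∑< r (λ s → f (suc s))
  ∑<-shift zero    f = +-comm _ _
  ∑<-shift (suc r) f = trans (+-congʳ (∑<-shift r f)) (+-assoc _ _ _)

  -- This is the recursion of `G`. A part that loses the first element may become empty, so it has
  -- to count as distinguished from then on. As `allSubsets` lists the sets containing the first
  -- element before the others, such a part comes first among the nonempty parts, at position `r`.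
  Z-suc : ∀ n r (F : List (Subset (suc n)) → Carrier) → Supported F →
    Z (suc n) r F ≈ Z n r (λ P → F (extendOut P))
      + (∑< r (λ s → Z n r (λ P → F (extendAt s P))) + Z n (suc r) (λ P → F (extendAt r P)))
  Z-suc n zero F sup = begin
    ∑L (sublists (List.map (inside ∷_) A ++ List.map (outside ∷_) A)) f
      ≈⟨ ∑L-sublists-++ (List.map (inside ∷_) A) (List.map (outside ∷_) A) f ⟩
    ∑L (sublists (List.map (inside ∷_) A)) (λ Q → ∑L (sublists (List.map (outside ∷_) A)) (λ P → f (Q ++ P)))
      ≈⟨ ∑L-cong (sublists (List.map (inside ∷_) A)) (λ Q → ∑L-sublists-map (outside ∷_) A _) ⟩
    ∑L (sublists (List.map (inside ∷_) A)) g
      ≈⟨ ∑L-sublists-map (inside ∷_) A g ⟩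
    ∑L (sublists A) (λ Q → g (List.map (inside ∷_) Q))
      -- Two parts containing the first element are not disjoint, so at most one remains.
      ≈⟨ ∑L-sublists-singletons A _ (λ S T Q → ∑L-0 (sublists A) (λ P →
           trans (*-congˡ (sup _ ≡.refl)) (zeroʳ _))) ⟩
    g [] + ∑L A (λ S → g ((inside ∷ S) ∷ []))
      ≈⟨ +-cong (drop (λ P → F (extendOut P)))
           (∑L-cong A (λ S → drop (λ P → F ((inside ∷ S) ∷ extendOut P)))) ⟩
    Z n 0 (λ P → F (extendOut P)) + Z n 1 (λ P → F (extendAt 0 P))
      ≈⟨ +-congˡ (+-identityˡ _) ⟨
    Z n 0 (λ P → F (extendOut P)) + (0# + Z n 1 (λ P → F (extendAt 0 P))) ∎
    where
    A = allSubsets n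

    f : List (Subset (suc n)) → Carrier
    f P = [ allL nonemptyᵇ P ] * F P

    g : List (Subset (suc n)) → Carrier
    g Q = ∑L (sublists A) (λ P → f (Q ++ extendOut P))

    drop : ∀ H → ∑L (sublists A) (λ P → [ allL nonemptyᵇ (extendOut P) ] * H P) ≈ Z n 0 H
    drop H = ∑L-cong (sublists A) (λ P → *-congʳ (reflexive (≡.cong [_] (nonempty-extendOut P))))
  Z-suc n (suc r) F sup = begin
    ∑L (List.map (inside ∷_) A ++ List.map (outside ∷_) A) f
      ≈⟨ ∑L-++ (List.map (inside ∷_) A) (List.map (outside ∷_) A) f ⟩
    ∑L (List.map (inside ∷_) A) f + ∑L (List.map (outside ∷_) A) f
      ≈⟨ +-cong (∑L-map (inside ∷_) A f) (∑L-map (outside ∷_) A f) ⟩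
    ∑L A (λ S → f (inside ∷ S)) + ∑L A (λ S → f (outside ∷ S))
      ≈⟨ +-cong (∑L-cong A with-zero) (∑L-cong A without-zero) ⟩
    a + ∑L A (λ S → Z n r (λ P → F ((outside ∷ S) ∷ extendOut P))
        + (∑< r (λ s → Z n r (λ P → F ((outside ∷ S) ∷ extendAt s P)))
          + Z n (suc r) (λ P → F ((outside ∷ S) ∷ extendAt r P))))
      ≈⟨ +-congˡ (trans (∑L-+ A _ _) (+-congˡ (trans (∑L-+ A _ _) (+-congʳ (∑L-∑< A r _))))) ⟩
    a + (o + (∑< r (λ s → h (suc s)) + w))
      ≈⟨ solve 4 (λ a o s w → a :+ (o :+ (s :+ w)) := o :+ ((a :+ s) :+ w)) refl a o _ w ⟩
    o + ((a + ∑< r (λ s → h (suc s))) + w)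
      -- Position 0 is the head `S`; positions in the tail move up by one.
      ≈⟨ +-congˡ (+-congʳ (∑<-shift r h)) ⟨
    o + (∑< (suc r) h + w) ∎
    where
    A = allSubsets n

    f : Subset (suc n) → Carrier
    f S = Z (suc n) r (λ P → F (S ∷ P))

    h : ℕ → Carrier
    h s = Z n (suc r) (λ P → F (extendAt s P))

    a = h 0
    o = Z n (suc r) (λ P → F (extendOut P))
    w = Z n (suc (suc r)) (λ P → F (extendAt (suc r) P))

    without-zero : ∀ S → f (outside ∷ S) ≈ _
    without-zero S = Z-suc n r _ (Supported-∷ {F = F} (outside ∷ S) sup)

    clash : ∀ S s P → s < length P → F ((inside ∷ S) ∷ extendAt s P) ≈ 0#
    clash S s P s<k = sup _ (≡.cong (_∧ pairwiseDisjointᵇ (extendAt s P)) (clash-extendAt s S P s<k))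

    -- Once the first distinguished part contains the new element, every term that puts it into
    -- another part vanishes.
    with-zero : ∀ S → f (inside ∷ S) ≈ Z n r (λ P → F ((inside ∷ S) ∷ extendOut P))
    with-zero S = begin
      f (inside ∷ S)
        ≈⟨ Z-suc n r _ (Supported-∷ {F = F} (inside ∷ S) sup) ⟩
      _ ≈⟨ +-congˡ (+-cong
             (trans (∑<-cong r (λ s s<r → Z-0 n r (λ P r≤k → clash S s P (ℕ.≤-trans s<r r≤k)))) (∑<-0 r))
             (Z-0 n (suc r) (clash S r))) ⟩
      Z n r (λ P → F ((inside ∷ S) ∷ extendOut P)) + (0# + 0#)
        ≈⟨ trans (+-congˡ (+-identityʳ 0#)) (+-identityʳ _) ⟩
      Z n r (λ P → F ((inside ∷ S) ∷ extendOut P)) ∎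

  Z≈G : ∀ n r (F : List (Subset n) → Carrier) → Supported F → Z n r F ≈ G r n (λ χ k → F (decode χ k))
  Z≈G zero zero F sup = begin
    -- The only subset of the empty ground set is empty, so the list of nonempty parts is empty.
    0# * F ([] ∷ []) + (1# * F [] + 0#)  ≈⟨ +-cong (zeroˡ _) (trans (+-identityʳ _) (*-identityˡ _)) ⟩
    0# + F []                            ≈⟨ +-identityˡ _ ⟩
    F []                                 ∎
  Z≈G zero (suc r) F sup = trans (+-identityʳ _) (Z≈G zero r _ (Supported-∷ {F = F} [] sup))
  Z≈G (suc n) r F sup = trans (Z-suc n r F sup) (+-cong
    (Z≈G n r _ (support nothing))
    (+-cong (∑<-cong r (λ s _ → Z≈G n r _ (support (just s)))) (Z≈G n (suc r) _ (support (just r)))))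
    where
    support : ∀ l → Supported (λ P → F (extendParts l P))
    support l P eq = sup (extendParts l P) (≡.trans (pairwiseDisjoint-extendParts l P) eq)

  -- Nonemptiness is built into `Z`; disjointness is put into the summand and holds for every
  -- decoded list.
  ∑-PP : ∀ n (f : List (Subset n) → Carrier) → ∑L (PP n) f ≈ G 0 n (λ χ k → f (decode χ k))
  ∑-PP n f = begin
    ∑L (PP n) f
      ≈⟨ ∑L-filter isPartialPartitionᵇ (sublists (allSubsets n)) f ⟩
    ∑L (sublists (allSubsets n)) (λ P → [ allL nonemptyᵇ P ∧ pairwiseDisjointᵇ P ] * f P)
      ≈⟨ ∑L-cong (sublists (allSubsets n)) (λ P → [∧] (allL nonemptyᵇ P)) ⟩
    Z n 0 (λ P → [ pairwiseDisjointᵇ P ] * f P)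
      ≈⟨ Z≈G n 0 _ (λ P eq → [false]* _ eq) ⟩
    G 0 n (λ χ k → [ pairwiseDisjointᵇ (decode χ k) ] * f (decode χ k))
      ≈⟨ G-cong 0 n (λ χ k → [true]* _ (pairwiseDisjoint-decode χ k)) ⟩
    G 0 n (λ χ k → f (decode χ k)) ∎
    where
    [∧] : ∀ a {b x} → [ a ∧ b ] * x ≈ [ a ] * ([ b ] * x)
    [∧] true  = sym (*-identityˡ _)
    [∧] false = trans (zeroˡ _) (sym (zeroˡ _))

  diagonal-balanced : ∀ {n} (A : Matrix n) → Balanced 0 (λ i → A i i) (diagonal A)
  diagonal-balanced A = record { out-sum = λ i → sym (+-identityʳ _) ; vanish = λ i l _ → refl }

  addDiagonal-offDiagonal : ∀ {n} (A : Matrix n) i j → addDiagonal (λ i → A i i) (offDiagonal A) i j ≈ A i j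
  addDiagonal-offDiagonal A i j with i ≟ j
  ... | yes ≡.refl = trans (+-identityˡ _) (*-identityˡ _)
  ... | no  _      = trans (+-congˡ (zeroˡ _)) (+-identityʳ _)

  ∑-summand : ∀ n (A : Matrix n) → ∑L (PP n) (summand A) ≈ det R n A
  ∑-summand n A = begin
    ∑L (PP n) (summand A)
      ≈⟨ ∑-PP n (summand A) ⟩
    G 0 n (λ χ k → summand A (decode χ k))
      ≈⟨ G-cong-bounded 0 n (λ χ k _ b → summand-decode A b) ⟩
    G 0 n (weight (diagonal A) (offDiagonal A))
      -- No part exists beforehand, and `κ 0` is 1.
      ≈⟨ G-weight n 0 (λ i → A i i) (diagonal A) (offDiagonal A) (diagonal-balanced A) ⟩
    κ 0 * Det (addDiagonal (λ i → A i i) (offDiagonal A))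
      ≈⟨ *-cong (trans (*-identityˡ _) (+-identityʳ 1#)) (Det-cong (addDiagonal-offDiagonal A)) ⟩
    1# * Det A
      ≈⟨ *-identityˡ _ ⟩
    Det A
      ≡⟨ Det-def A ⟩
    det R n A ∎

  -- `p` divides `p !`, which divides `k !`.
  natCast-! : ∀ {p k} → 0 < p → natCast R p ≈ 0# → p ≤ k → natCast R (k !) ≈ 0#
  natCast-! {suc p} {k} _ char p≤k with ∣-trans (m∣m*n {suc p} (p !)) (m≤n⇒m!∣n! p≤k)
  ... | divides q eq = begin
    natCast R (k !)                 ≡⟨ ≡.cong (natCast R) eq ⟩
    natCast R (q ℕ.* suc p)         ≈⟨ natCast-* q (suc p) ⟩
    natCast R q * natCast R (suc p) ≈⟨ *-congˡ char ⟩
    natCast R q * 0#                ≈⟨ zeroʳ _ ⟩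
    0#                              ∎

  rhs≈∑-summand : ∀ p n (A : Matrix n) → 0 < p → natCast R p ≈ 0# → rhs R p n A ≈ ∑L (PP n) (summand A)
  rhs≈∑-summand p n A 0<p char = trans (∑L-filter _ (PP n) (summand A)) (∑L-cong (PP n) truncate)
    where
    truncate : ∀ P → [ suc (numParts P) ≤ᵇ p ] * summand A P ≈ summand A P
    -- The bound |P| ≤ p - 1 is written as `suc (numParts P) ≤ᵇ p`; its failure means
    -- `p ≤ numParts P`.
    truncate P with suc (numParts P) ≤ᵇ p in eq
    ... | true  = *-identityˡ _
    ... | false = trans (zeroˡ _) (sym (trans (*-congˡ (trans (*-congʳ (natCast-! 0<p char p≤)) (zeroˡ _))) (zeroʳ _)))
      where
      p≤ : p ≤ numParts P
      p≤ = ℕ.≤-pred (ℕ.≰⇒> (λ h → ≡.subst T eq (ℕ.≤⇒≤ᵇ h)))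

theorem5p1 : ∀ {c ℓ} (F : CommutativeRing c ℓ) → IsField F →
    (p : ℕ) → HasCharacteristic F p →
    (n : ℕ) (A : Fin n → Fin n → CommutativeRing.Carrier F) →
    CommutativeRing._≈_ F (det F n A) (rhs F p n A)
theorem5p1 F _ p (0<p , char , _) n A = sym (trans (rhs≈∑-summand p n A 0<p char) (∑-summand n A))
  where
  open CommutativeRing F using (sym; trans)
  open Parts F
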